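{- Let $\phi=\phi_{\mathbb{Z}[i]}$ be the minimal Euclidean function on $\mathbb{Z}[i]$. For every integer $k\ge 1$, \[ \phi^{ -1}(2k+1)=\coprod_{j=0}^{k}\left\{a+bi:\ \begin{array}{c}2^j\parallel (a+bi);\ |a|,|b|\le w_{2k+1}-2^{j+1};\ |a|+|b|\le w_{2k+2}-3\cdot 2^j;\\ \text{and either } \max(|a|,|b|)>w_{2k}-2^{j+1} \text{ or } |a|+|b|>w_{2k+1}-3\cdot 2^j\end{array}\right\} \] and \[ \phi^{ -1}(2k)=\{\pm 2^k,\pm 2^k i\}\ \cup\ \coprod_{j=0}^{k-1}\left\{a+bi:\ \begin{array}{c}2^j\parallel (a+bi);\ |a|,|b|\le w_{2k}-2^{j+1};\ |a|+|b|\le w_{2k+1}-3\cdot 2^j;\\ \text{and either } \max(|a|,|b|)>w_{2k-1}-2^{j+1} \text{ or } |a|+|b|>w_{2k}-3\cdot 2^j\end{array}\right\}. \]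
   Context: For $k\ge 0$ set $w_{2k}=3\cdot 2^k$ and $w_{2k+1}=4\cdot 2^k$. For a Gaussian integer $z\neq 0$, $2^j\parallel z$ means $2^j$ divides $z$ in $\mathbb{Z}[i]$ but $2^{j+1}$ does not. For $M\subseteq\mathbb{Z}[i]$ and $\beta\in\mathbb{Z}[i]$, write $M\twoheadrightarrow \mathbb{Z}[i]/\beta$ if every residue class of $\mathbb{Z}[i]/(\beta)$ has a representative in $M$. The Motzkin sets are $A_{\mathbb{Z}[i],0}=\{0,\pm1,\pm i\}$ and, for $j\ge1$, $A_{\mathbb{Z}[i],j}=A_{\mathbb{Z}[i],j-1}\cup\{\beta: A_{\mathbb{Z}[i],j-1}\twoheadrightarrow\mathbb{Z}[i]/\beta\}$. The minimal Euclidean function $\phi_{\mathbb{Z}[i]}:\mathbb{Z}[i]\setminus 0\to\mathbb{N}$ is $\phi_{\mathbb{Z}[i]}(a)=j$ where $j$ is least with $a\in A_{\mathbb{Z}[i],j}$ (equivalently, the pointwise minimum of all Euclidean functions on $\mathbb{Z}[i]$). -}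

module Defs where

open import Data.Nat as ℕ using (ℕ; zero; suc; _<_; _^_; _/_; _%_)
open import Data.Integer as ℤ using (ℤ; +_; ∣_∣)
open import Data.Product using (_×_; _,_; ∃; ∃-syntax)
open import Data.Sum using (_⊎_)
open import Relation.Nullary using (¬_)
open import Relation.Binary.PropositionalEquality using (_≡_; _≢_)

record ℤ[i] : Set where
  constructor _+_i
  field
    re : ℤ
    im : ℤ
open ℤ[i] public

0ᵍ 1ᵍ iᵍ : ℤ[i]
0ᵍ = (+ 0) + (+ 0) i
1ᵍ = (+ 1) + (+ 0) i
iᵍ = (+ 0) + (+ 1) i

-ᵍ_ : ℤ[i] → ℤ[i]
-ᵍ (a + b i) = (ℤ.- a) + (ℤ.- b) i

_-ᵍ_ : ℤ[i] → ℤ[i] → ℤ[i]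
(a + b i) -ᵍ (c + d i) = (a ℤ.- c) + (b ℤ.- d) i

_*ᵍ_ : ℤ[i] → ℤ[i] → ℤ[i]
(a + b i) *ᵍ (c + d i) = (a ℤ.* c ℤ.- b ℤ.* d) + (a ℤ.* d ℤ.+ b ℤ.* c) i

ι : ℤ → ℤ[i]
ι n = n + (+ 0) i

_∣ᵍ_ : ℤ[i] → ℤ[i] → Set
β ∣ᵍ z = ∃[ q ] z ≡ β *ᵍ q

_∥2^_ : ℤ[i] → ℕ → Set
z ∥2^ j = (ι (+ (2 ^ j)) ∣ᵍ z) × ¬ (ι (+ (2 ^ suc j)) ∣ᵍ z)

-- w_{2k} = 3·2^k , w_{2k+1} = 4·2^k

w : ℕ → ℕ
w n = (3 ℕ.+ n % 2) ℕ.* 2 ^ (n / 2)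

_↠mod_ : (ℤ[i] → Set) → ℤ[i] → Set
M ↠mod β = ∀ (x : ℤ[i]) → ∃[ m ] (M m × (β ∣ᵍ (x -ᵍ m)))

A : ℕ → ℤ[i] → Set
A zero z = (z ≡ 0ᵍ) ⊎ (z ≡ 1ᵍ) ⊎ (z ≡ -ᵍ 1ᵍ) ⊎ (z ≡ iᵍ) ⊎ (z ≡ -ᵍ iᵍ)
A (suc j) β = A j β ⊎ (A j ↠mod β)

φ_≡_ : ℤ[i] → ℕ → Set
φ z ≡ n = (z ≢ 0ᵍ) × A n z × (∀ m → m < n → ¬ A m z)

ℤ⟨_⟩ : ℕ → ℤ
ℤ⟨ n ⟩ = + n

Piece : (m mPrev j : ℕ) → ℤ[i] → Set
Piece m mPrev j z =
  (z ∥2^ j)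
  × (ℤ⟨ ∣ a ∣ ⟩ ℤ.≤ ℤ⟨ w m ⟩ ℤ.- ℤ⟨ 2 ^ suc j ⟩)
  × (ℤ⟨ ∣ b ∣ ⟩ ℤ.≤ ℤ⟨ w m ⟩ ℤ.- ℤ⟨ 2 ^ suc j ⟩)
  × (ℤ⟨ ∣ a ∣ ℕ.+ ∣ b ∣ ⟩ ℤ.≤ ℤ⟨ w (suc m) ⟩ ℤ.- ℤ⟨ 3 ℕ.* 2 ^ j ⟩)
  × ( (ℤ⟨ ∣ a ∣ ℕ.⊔ ∣ b ∣ ⟩ ℤ.> ℤ⟨ w mPrev ⟩ ℤ.- ℤ⟨ 2 ^ suc j ⟩)
    ⊎ (ℤ⟨ ∣ a ∣ ℕ.+ ∣ b ∣ ⟩ ℤ.> ℤ⟨ w m ⟩ ℤ.- ℤ⟨ 3 ℕ.* 2 ^ j ⟩))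
  where
  a = re z
  b = im z

OddRHS : ℕ → ℤ[i] → Set
OddRHS k z = ∃[ j ] (j ℕ.≤ k × Piece (2 ℕ.* k ℕ.+ 1) (2 ℕ.* k) j z)

EvenRHS : ℕ → ℤ[i] → Set
EvenRHS k z =
  ( (z ≡ (+ (2 ^ k)) + (+ 0) i) ⊎ (z ≡ (ℤ.- (+ (2 ^ k))) + (+ 0) i)
  ⊎ (z ≡ (+ 0) + (+ (2 ^ k)) i) ⊎ (z ≡ (+ 0) + (ℤ.- (+ (2 ^ k))) i) )
  ⊎ ∃[ j ] (j < k × Piece (2 ℕ.* k) (2 ℕ.* k ℕ.∸ 1) j z)

{-# OPTIONS --safe #-}

-- Let M and L be the maximum norm and the 1-norm of ℤ[i]. Multiplication by 1 + i exchanges them,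
-- M((1 + i)z) = L(z) and L((1 + i)z) = 2 M(z), and w (n + 2) = 2 w n. Call z odd if 1 + i ∤ z. The
-- n-th Motzkin set is T n, which consists of 0 and the (1 + i)^v z with v ≤ n, z odd,
-- M(z) ≤ w (n − v) − 2 and L(z) ≤ w (n − v + 1) − 3. For this one has to see that T n meets every
-- residue class mod β ≠ 0 if and only if β ∈ T (n + 1). Division by 1 + i settles even β, except for
-- odd classes modulo even β, which are covered by rounding.
-- If β is odd, every representative m of the class of (1 + i)(β − 1)/2 satisfies 2 M(m) ≥ L(β) − 1
-- and L(m) ≥ M(β) − 1, which bounds β. Conversely rounding gives each class a representative m with
-- 2 M(m) ≤ L(β) and L(m) ≤ M(β). If m is odd, it lies in T n. If m is even and not in T n, then
-- M(m) = w n − d or L(m) = w (n + 1) − d for a divisor d of m or of (1 + i)m, and for some unit u the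
-- number m − uβ is odd and lies in T n.

module Submission where

open import Defs
open import Data.Nat using (ℕ; _≤_)
open import Data.Product using (_×_)
open import Function.Bundles using (_⇔_)

open import Algebra.Properties.CommutativeSemigroup using (x∙yz≈y∙xz)
open import Data.Empty using (⊥-elim)
open import Data.Integer using (ℤ; +_; -[1+_]; +[1+_]; _+_; _-_; _*_; -_; ∣_∣; +≤+)
  renaming (_≤_ to _≤ᶻ_)
import Data.Integer as ℤ
import Data.Integer.DivMod as ℤ
import Data.Integer.Properties as ℤ
open import Data.Integer.Tactic.RingSolver using (solve)
open import Data.List using ([]; _∷_)
open import Data.Nat using (zero; suc)
import Data.Nat as ℕ
import Data.Nat.DivMod as ℕ
import Data.Nat.Properties as ℕ
open import Data.Product using (_,_; proj₁; proj₂; ∃-syntax)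
open import Data.Sum using (_⊎_; inj₁; inj₂)
open import Function using (_∋_; case_of_)
open import Function.Bundles using (mk⇔)
open import Relation.Binary.PropositionalEquality
  using (_≡_; _≢_; refl; sym; trans; cong; cong₂; subst)
open import Relation.Nullary using (¬_; yes; no)

-- Linear arithmetic and parity over the integers.

pattern ⟪_,_⟫ a b = a + b i

infixl 6 _⊕_

_⊕_ : ∀ {a b c d} → a ≤ᶻ b → c ≤ᶻ d → a + c ≤ᶻ b + d
_⊕_ = ℤ.+-mono-≤

-- A certificate for a linear inequality: `h` adds up the hypotheses with their multiplicities, `n`
-- is the slack that remains, and `e` is an identity for the ring solver.
lin : ∀ {a b c d} n → a ≤ᶻ b → d - c ≡ b - a + + n → c ≤ᶻ d
lin n h e =
  ℤ.0≤i-j⇒j≤i (subst (+ 0 ≤ᶻ_) (sym e) (ℤ.+-mono-≤ (ℤ.i≤j⇒0≤j-i h) (+≤+ ℕ.z≤n)))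

lin≡ : ∀ {a b c d : ℤ} → a ≡ b → c - d ≡ a - b → c ≡ d
lin≡ {a} refl e = ℤ.i-j≡0⇒i≡j _ _ (trans e (ℤ.+-inverseʳ a))

absurd : ∀ {a b} {A : Set} n → a ≤ᶻ b → a - b ≡ +[1+ n ] → A
absurd {a} {b} n h e with subst (_≤ᶻ + 0) e (ℤ.i≤j⇒i-j≤0 h)
... | +≤+ ()

dichotomy : ∀ a b → a ≤ᶻ b ⊎ b + + 1 ≤ᶻ a
dichotomy a b with a ℤ.≤? b
... | yes a≤b = inj₁ a≤b
... | no  a≰b = inj₂ (subst (_≤ᶻ a) (ℤ.+-comm (+ 1) b) (ℤ.i<j⇒suc[i]≤j (ℤ.≰⇒> a≰b)))

by-cases : ∀ {A B C : Set} → A ⊎ B → (A → C) → (B → C) → C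
by-cases (inj₁ a) f g = f a
by-cases (inj₂ b) f g = g b

half-≤ : ∀ {a b} → + 2 * a ≤ᶻ + 2 * b + + 1 → a ≤ᶻ b
half-≤ {a} {b} h = by-cases (dichotomy a b)
  (λ a≤b → a≤b)
  (λ b<a → absurd 0 (h ⊕ b<a ⊕ b<a) (solve (a ∷ b ∷ [])))

odd-≤-even : ∀ {a b} → + 2 * a + + 1 ≤ᶻ + 2 * b → + 2 * a + + 2 ≤ᶻ + 2 * b
odd-≤-even {a} {b} h = by-cases (dichotomy b a)
  (λ b≤a → absurd 0 (h ⊕ b≤a ⊕ b≤a) (solve (a ∷ b ∷ [])))
  (λ a<b → (+ 2 * a + + 2 ≤ᶻ + 2 * b ∋ lin 0 (a<b ⊕ a<b) (solve (b ∷ a ∷ []))))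

odd≢even : ∀ {a b} → + 2 * a + + 1 ≢ + 2 * b
odd≢even {a} {b} e =
  absurd 0 (odd-≤-even {a} {b} (ℤ.≤-reflexive e) ⊕ ℤ.≤-reflexive (sym e)) (solve (a ∷ b ∷ []))

2*-injective : ∀ {a b} → + 2 * a ≡ + 2 * b → a ≡ b
2*-injective {a} {b} = ℤ.*-cancelˡ-≡ (+ 2) a b

parityᶻ : ∀ a → (∃[ c ] a ≡ + 2 * c + + 1) ⊎ (∃[ c ] a ≡ + 2 * c)
parityᶻ a = go (a ℤ.%ℕ 2) (ℤ.n%ℕd<d a 2) (a ℤ./ℕ 2) (ℤ.a≡a%ℕn+[a/ℕn]*n a 2)
  where
  go : ∀ r → r ℕ.< 2 → ∀ c → a ≡ + r + c * + 2 →
    (∃[ c ] a ≡ + 2 * c + + 1) ⊎ (∃[ c ] a ≡ + 2 * c)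
  go 0 _ c e = inj₂ (c , trans e (solve (c ∷ [])))
  go 1 _ c e = inj₁ (c , trans e (solve (c ∷ [])))
  go (suc (suc r)) (ℕ.s≤s (ℕ.s≤s ())) c e

-- Multiplication by i (`rot`), by 1 + i (`τ`) and by 2 (`twice`).

rot τ twice : ℤ[i] → ℤ[i]
rot ⟪ a , b ⟫ = ⟪ - b , a ⟫
τ ⟪ a , b ⟫ = ⟪ a - b , a + b ⟫
twice ⟪ a , b ⟫ = ⟪ + 2 * a , + 2 * b ⟫

-- Every Gaussian integer is a power of i times one in the closed first quadrant.
rot-induction : (P : ℤ[i] → Set) → (∀ z → P z → P (rot z)) →
  (∀ a b → + 0 ≤ᶻ a → + 0 ≤ᶻ b → P ⟪ a , b ⟫) → ∀ z → P z
rot-induction P step base = go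
  where
  first : ∀ m n → P ⟪ + m , + n ⟫
  first m n = base (+ m) (+ n) (+≤+ ℕ.z≤n) (+≤+ ℕ.z≤n)
  second : ∀ m n → P ⟪ -[1+ m ] , + n ⟫
  second m n = step ⟪ + n , +[1+ m ] ⟫ (first n (suc m))
  go : ∀ z → P z
  go ⟪ + m , + n ⟫ = first m n
  go ⟪ -[1+ m ] , + n ⟫ = second m n
  go ⟪ -[1+ m ] , -[1+ n ] ⟫ = step ⟪ -[1+ n ] , +[1+ m ] ⟫ (second n (suc m))
  go ⟪ + zero , -[1+ n ] ⟫ = step ⟪ -[1+ n ] , + 0 ⟫ (second n 0)
  go ⟪ +[1+ m ] , -[1+ n ] ⟫ =
    step ⟪ -[1+ n ] , -[1+ m ] ⟫ (step ⟪ -[1+ m ] , +[1+ n ] ⟫ (second m (suc n)))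

τ-rot : ∀ z → τ (rot z) ≡ rot (τ z)
τ-rot ⟪ a , b ⟫ = cong₂ _+_i
  (- b - a ≡ - (a + b) ∋ solve (b ∷ a ∷ []))
  (- b + a ≡ a - b ∋ solve (b ∷ a ∷ []))

ττ : ∀ z → τ (τ z) ≡ rot (twice z)
ττ ⟪ a , b ⟫ = cong₂ _+_i
  (a - b - (a + b) ≡ - (+ 2 * b) ∋ solve (a ∷ b ∷ []))
  (a - b + (a + b) ≡ + 2 * a ∋ solve (a ∷ b ∷ []))

τ-injective : ∀ {y z} → τ y ≡ τ z → y ≡ z
τ-injective {⟪ a , b ⟫} {⟪ c , d ⟫} e = cong₂ _+_i
  (2*-injective (trans (+ 2 * a ≡ a - b + (a + b) ∋ solve (a ∷ b ∷ []))
    (trans (cong₂ _+_ p q) (c - d + (c + d) ≡ + 2 * c ∋ solve (c ∷ d ∷ [])))))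
  (2*-injective (trans (+ 2 * b ≡ a + b - (a - b) ∋ solve (b ∷ a ∷ []))
    (trans (cong₂ _-_ q p) (c + d - (c - d) ≡ + 2 * d ∋ solve (c ∷ d ∷ [])))))
  where
  p = cong re e
  q = cong im e

τ-*ᵍ : ∀ β z → τ (β *ᵍ z) ≡ τ β *ᵍ z
τ-*ᵍ ⟪ a , b ⟫ ⟪ c , d ⟫ =
  cong₂ _+_i
    (a * c - b * d - (a * d + b * c) ≡ (a - b) * c - (a + b) * d ∋ solve (a ∷ c ∷ b ∷ d ∷ []))
    (a * c - b * d + (a * d + b * c) ≡ (a - b) * d + (a + b) * c ∋ solve (a ∷ c ∷ b ∷ d ∷ []))

rot-*ᵍ : ∀ β z → rot β *ᵍ z ≡ rot (β *ᵍ z)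
rot-*ᵍ ⟪ a , b ⟫ ⟪ c , d ⟫ =
  cong₂ _+_i
    (- b * c - a * d ≡ - (a * d + b * c) ∋ solve (b ∷ c ∷ a ∷ d ∷ []))
    (- b * d + a * c ≡ a * c - b * d ∋ solve (b ∷ d ∷ a ∷ c ∷ []))

*ᵍ-rot : ∀ β z → β *ᵍ rot z ≡ rot (β *ᵍ z)
*ᵍ-rot ⟪ a , b ⟫ ⟪ c , d ⟫ =
  cong₂ _+_i
    (a * - d - b * c ≡ - (a * d + b * c) ∋ solve (a ∷ d ∷ b ∷ c ∷ []))
    (a * c + b * - d ≡ a * c - b * d ∋ solve (a ∷ c ∷ b ∷ d ∷ []))

τ--ᵍ : ∀ y z → τ (y -ᵍ z) ≡ τ y -ᵍ τ z
τ--ᵍ ⟪ a , b ⟫ ⟪ c , d ⟫ =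
  cong₂ _+_i
    (a - c - (b - d) ≡ a - b - (c - d) ∋ solve (a ∷ c ∷ b ∷ d ∷ []))
    (a - c + (b - d) ≡ a + b - (c + d) ∋ solve (a ∷ c ∷ b ∷ d ∷ []))

-- Divisibility by 1 + i.

-- 1 + i divides a + bi exactly if a + b is even. `Odd` is stated through this sum, `Even` through
-- the quotient that descents by 1 + i use.
Odd Even : ℤ[i] → Set
Odd z = ∃[ c ] re z + im z ≡ + 2 * c + + 1
Even z = ∃[ y ] z ≡ τ y

even-sum⇒Even : ∀ z c → re z + im z ≡ + 2 * c → Even z
even-sum⇒Even ⟪ a , b ⟫ c e = ⟪ c , c - a ⟫ ,
  cong₂ _+_i
    (solve (a ∷ c ∷ []))
    (trans (b ≡ a + b - a ∋ solve (b ∷ a ∷ []))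
      (trans (cong (_- a) e) (+ 2 * c - a ≡ c + (c - a) ∋ solve (c ∷ a ∷ []))))

parity : ∀ z → Odd z ⊎ Even z
parity z with parityᶻ (re z + im z)
... | inj₁ o = inj₁ o
... | inj₂ (c , e) = inj₂ (even-sum⇒Even z c e)

τ-not-Odd : ∀ {y} → ¬ Odd (τ y)
τ-not-Odd {⟪ a , b ⟫} (c , e) =
  odd≢even {c} {a} (trans (sym e) (a - b + (a + b) ≡ + 2 * a ∋ solve (a ∷ b ∷ [])))

-- Maximum norm and 1-norm.

-- M(z) ≤ K as four linear inequalities, the form that `lin` takes. L(z) ≤ K is written
-- `Sup K (τ z)`, because M((1 + i)z) = L(z).
record Sup (K : ℤ) (z : ℤ[i]) : Set where
  constructor sup
  field
    re≤ : re z ≤ᶻ K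
    -re≤ : - re z ≤ᶻ K
    im≤ : im z ≤ᶻ K
    -im≤ : - im z ≤ᶻ K

Sup-rot : ∀ {K z} → Sup K z → Sup K (rot z)
Sup-rot {K} {z} (sup a b c d) = sup d (subst (_≤ᶻ K) (sym (ℤ.neg-involutive (im z))) c) a b

Sup-rot⁻¹ : ∀ {K z} → Sup K (rot z) → Sup K z
Sup-rot⁻¹ {K} {z} (sup a b c d) = sup c d (subst (_≤ᶻ K) (ℤ.neg-involutive (im z)) b) a

Sup-mono : ∀ {K K′ z} → K ≤ᶻ K′ → Sup K z → Sup K′ z
Sup-mono k (sup a b c d) =
  sup (ℤ.≤-trans a k) (ℤ.≤-trans b k) (ℤ.≤-trans c k) (ℤ.≤-trans d k)

Sup-twice : ∀ {K z} → Sup K z → Sup (+ 2 * K) (twice z)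
Sup-twice {K} {⟪ a , b ⟫} (sup p q r s) = sup
  (+ 2 * a ≤ᶻ + 2 * K ∋ lin 0 (p ⊕ p) (solve (K ∷ a ∷ [])))
  (- (+ 2 * a) ≤ᶻ + 2 * K ∋ lin 0 (q ⊕ q) (solve (K ∷ a ∷ [])))
  (+ 2 * b ≤ᶻ + 2 * K ∋ lin 0 (r ⊕ r) (solve (K ∷ b ∷ [])))
  (- (+ 2 * b) ≤ᶻ + 2 * K ∋ lin 0 (s ⊕ s) (solve (K ∷ b ∷ [])))

-- The coordinates of `twice z` are even, so the bound 2K + 1 is as good as 2K.
Sup-twice⁻¹ : ∀ {K z} → Sup (+ 2 * K + + 1) (twice z) → Sup K z
Sup-twice⁻¹ {K} {⟪ a , b ⟫} (sup p q r s) =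
  sup
    (half-≤ p)
    (half-≤ (lin 0 q (+ 2 * K + + 1 - + 2 * - a ≡ + 2 * K + + 1 - - (+ 2 * a) + + 0 ∋
      solve (K ∷ a ∷ []))))
    (half-≤ r)
    (half-≤ (lin 0 s (+ 2 * K + + 1 - + 2 * - b ≡ + 2 * K + + 1 - - (+ 2 * b) + + 0 ∋
      solve (K ∷ b ∷ []))))

Sup-ττ : ∀ {K z} → Sup K z → Sup (+ 2 * K) (τ (τ z))
Sup-ττ {z = z} s = subst (Sup _) (sym (ττ z)) (Sup-rot (Sup-twice {z = z} s))

Sup-ττ⁻¹ : ∀ {K z} → Sup (+ 2 * K + + 1) (τ (τ z)) → Sup K z
Sup-ττ⁻¹ {z = z} s = Sup-twice⁻¹ {z = z} (Sup-rot⁻¹ (subst (Sup _) (ττ z) s))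

-- Both coordinates of (1 + i)z are odd when z is, so an even bound on them drops by one.
Odd-Sup : ∀ {z v} → Odd z → Sup (+ 2 * v - + 2) (τ z) → Sup (+ 2 * v - + 3) (τ z)
Odd-Sup {⟪ a , b ⟫} {v} (s , e) (sup p q r t) =
  sup (f (s - b) e₁ p) (f (b - s - + 1) e₂ q) (f s e r) (f (- s - + 1) e₃ t)
  where
  f : ∀ {x} c → x ≡ + 2 * c + + 1 → x ≤ᶻ + 2 * v - + 2 → x ≤ᶻ + 2 * v - + 3
  f c refl h = lin 0 (odd-≤-even {c} {v - + 1} (lin 0 h (solve (v ∷ c ∷ [])))) (solve (v ∷ c ∷ []))
  e₁ : a - b ≡ + 2 * (s - b) + + 1
  e₁ = trans (a - b ≡ a + b - + 2 * b ∋ solve (a ∷ b ∷ []))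
    (trans (cong (λ t → t - + 2 * b) e)
      (+ 2 * s + + 1 - + 2 * b ≡ + 2 * (s - b) + + 1 ∋ solve (s ∷ b ∷ [])))
  e₂ : - (a - b) ≡ + 2 * (b - s - + 1) + + 1
  e₂ = trans (cong -_ e₁) (solve (s ∷ b ∷ []))
  e₃ : - (a + b) ≡ + 2 * (- s - + 1) + + 1
  e₃ = trans (cong -_ e) (solve (s ∷ []))

Exceeds : ℤ → ℤ[i] → Set
Exceeds K z = K + + 1 ≤ᶻ re z ⊎ K + + 1 ≤ᶻ - re z ⊎ K + + 1 ≤ᶻ im z ⊎ K + + 1 ≤ᶻ - im z

Sup? : ∀ K z → Sup K z ⊎ Exceeds K z
Sup? K z with dichotomy (re z) K | dichotomy (- re z) K | dichotomy (im z) K | dichotomy (- im z) K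
... | inj₁ a | inj₁ b | inj₁ c | inj₁ d = inj₁ (sup a b c d)
... | inj₂ a | _ | _ | _ = inj₂ (inj₁ a)
... | inj₁ _ | inj₂ b | _ | _ = inj₂ (inj₂ (inj₁ b))
... | inj₁ _ | inj₁ _ | inj₂ c | _ = inj₂ (inj₂ (inj₂ (inj₁ c)))
... | inj₁ _ | inj₁ _ | inj₁ _ | inj₂ d = inj₂ (inj₂ (inj₂ (inj₂ d)))

-- Norms of products.

*-mono : ∀ {k a b} → + 0 ≤ᶻ k → a ≤ᶻ b → k * a ≤ᶻ k * b
*-mono {k} 0≤k = ℤ.*-monoˡ-≤-nonNeg k {{ℤ.nonNegative 0≤k}}

positive : ∀ {a} → + 0 ≤ᶻ a → a ≢ + 0 → + 1 ≤ᶻ a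
positive {a} 0≤a a≢0 = by-cases (dichotomy a (+ 0))
  (λ a≤0 → ⊥-elim (a≢0 (ℤ.≤-antisym a≤0 0≤a)))
  (λ 1≤a → 1≤a)

-- M(βs) ≥ L(β) if both coordinates of s are nonzero: once β = k + li and s = S + Ti are rotated
-- into the first quadrant, the imaginary part of βs is kT + lS with S, T ≥ 1.
τ-Sup-by-multiple : ∀ {K} s → re s ≢ + 0 → im s ≢ + 0 → ∀ β → Sup K (β *ᵍ s) → Sup K (τ β)
τ-Sup-by-multiple {K} = rot-induction P step base
  where
  P : ℤ[i] → Set
  P s = re s ≢ + 0 → im s ≢ + 0 → ∀ β → Sup K (β *ᵍ s) → Sup K (τ β)
  step : ∀ s → P s → P (rot s)
  step s h p q β b = h q (λ e → p (cong -_ e)) β (Sup-rot⁻¹ (subst (Sup K) (*ᵍ-rot β s) b))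
  base : ∀ S T → + 0 ≤ᶻ S → + 0 ≤ᶻ T → P ⟪ S , T ⟫
  base S T 0≤S 0≤T S≢0 T≢0 = rot-induction Q step′ base′
    where
    s : ℤ[i]
    s = ⟪ S , T ⟫
    Q : ℤ[i] → Set
    Q β = Sup K (β *ᵍ s) → Sup K (τ β)
    step′ : ∀ β → Q β → Q (rot β)
    step′ β h b = subst (Sup K) (sym (τ-rot β))
      (Sup-rot (h (Sup-rot⁻¹ (subst (Sup K) (rot-*ᵍ β s) b))))
    base′ : ∀ k l → + 0 ≤ᶻ k → + 0 ≤ᶻ l → Q ⟪ k , l ⟫
    base′ k l 0≤k 0≤l (sup _ _ b _) =
      sup
        (k - l ≤ᶻ K ∋ lin 0 (h ⊕ 0≤l ⊕ 0≤l) (solve (K ∷ k ∷ l ∷ T ∷ S ∷ [])))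
        (- (k - l) ≤ᶻ K ∋ lin 0 (h ⊕ 0≤k ⊕ 0≤k) (solve (K ∷ k ∷ l ∷ T ∷ S ∷ [])))
        (k + l ≤ᶻ K ∋ lin 0 h (solve (K ∷ k ∷ l ∷ T ∷ S ∷ [])))
        (- (k + l) ≤ᶻ K ∋ lin 0 (h ⊕ 0≤k ⊕ 0≤k ⊕ 0≤l ⊕ 0≤l) (solve (K ∷ k ∷ l ∷ T ∷ S ∷ [])))
      where
      h : (k * T + l * S) + (k * + 1) + (l * + 1) ≤ᶻ K + k * T + l * S
      h = b ⊕ *-mono 0≤k (positive 0≤T T≢0) ⊕ *-mono 0≤l (positive 0≤S S≢0)

-- M(βξ) ≤ M(ξ) L(β): with β = k + li rotated to k, l ≥ 0, each coordinate of βξ is at most N(k + l)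
-- in absolute value.
Sup-*ᵍ : ∀ {K N ξ} → Sup N ξ → ∀ β → Sup K (τ β) → Sup (N * K) (β *ᵍ ξ)
Sup-*ᵍ {K} {N} {ξ@(⟪ X , Y ⟫)} (sup X≤ -X≤ Y≤ -Y≤) = rot-induction P step base
  where
  P : ℤ[i] → Set
  P β = Sup K (τ β) → Sup (N * K) (β *ᵍ ξ)
  step : ∀ β → P β → P (rot β)
  step β h b = subst (Sup (N * K)) (sym (rot-*ᵍ β ξ))
    (Sup-rot (h (Sup-rot⁻¹ (subst (Sup K) (τ-rot β) b))))
  0≤N : + 0 ≤ᶻ N
  0≤N = half-≤ (lin 1 (X≤ ⊕ -X≤) (solve (N ∷ X ∷ [])))
  base : ∀ k l → + 0 ≤ᶻ k → + 0 ≤ᶻ l → P ⟪ k , l ⟫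
  base k l 0≤k 0≤l (sup _ _ b _) =
    sup
      (k * X - l * Y ≤ᶻ N * K ∋ lin 0 (h ⊕ *-mono 0≤k X≤ ⊕ *-mono 0≤l -Y≤)
        (solve (N ∷ K ∷ k ∷ X ∷ l ∷ Y ∷ [])))
      (- (k * X - l * Y) ≤ᶻ N * K ∋ lin 0 (h ⊕ *-mono 0≤k -X≤ ⊕ *-mono 0≤l Y≤)
        (solve (N ∷ K ∷ k ∷ X ∷ l ∷ Y ∷ [])))
      (k * Y + l * X ≤ᶻ N * K ∋ lin 0 (h ⊕ *-mono 0≤k Y≤ ⊕ *-mono 0≤l X≤)
        (solve (N ∷ K ∷ k ∷ Y ∷ l ∷ X ∷ [])))
      (- (k * Y + l * X) ≤ᶻ N * K ∋ lin 0 (h ⊕ *-mono 0≤k -Y≤ ⊕ *-mono 0≤l -X≤)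
        (solve (N ∷ K ∷ k ∷ Y ∷ l ∷ X ∷ [])))
    where
    h : N * (k + l) ≤ᶻ N * K
    h = *-mono 0≤N b

Sup-cancel : ∀ {K N z} → + 1 ≤ᶻ N → Sup (N * K) ⟪ N * re z , N * im z ⟫ → Sup K z
Sup-cancel {K} {N} {⟪ x , y ⟫} 1≤N (sup a b c d) =
  sup
    (cancel a)
    (cancel (lin 0 b (solve (N ∷ K ∷ x ∷ []))))
    (cancel c)
    (cancel (lin 0 d (solve (N ∷ K ∷ y ∷ []))))
  where
  cancel : ∀ {u} → N * u ≤ᶻ N * K → u ≤ᶻ K
  cancel {u} = ℤ.*-cancelˡ-≤-pos u K N {{ℤ.positive (ℤ.suc[i]≤j⇒i<j 1≤N)}}

-- Division with rounding.

divMod : ∀ a m → + 1 ≤ᶻ m → ∃[ q ] ∃[ r ] a ≡ r + q * m × + 0 ≤ᶻ r × r + + 1 ≤ᶻ m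
divMod a +[1+ k ] _ =
  a ℤ./ℕ suc k , + (a ℤ.%ℕ suc k) , ℤ.a≡a%ℕn+[a/ℕn]*n a (suc k) , +≤+ ℕ.z≤n ,
  subst (_≤ᶻ +[1+ k ]) (ℤ.+-comm (+ 1) (+ (a ℤ.%ℕ suc k))) (+≤+ (ℤ.n%ℕd<d a (suc k)))
divMod a (+ 0) (+≤+ ())

round : ∀ X N → + 1 ≤ᶻ N →
  ∃[ q ] + 2 * (X - N * q) ≤ᶻ N × - (+ 2 * (X - N * q)) ≤ᶻ N
-- The quotient is the floor of X/N + 1/2, so the remainder is at most N/2 on either side.
round X N 1≤N = case divMod (+ 2 * X + N) (+ 2 * N) (lin 1 (1≤N ⊕ 1≤N) (solve (N ∷ []))) of λ where
  (q , r , e , 0≤r , r<2N) → q ,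
    (+ 2 * (X - N * q) ≤ᶻ N ∋ lin 1 (ℤ.≤-reflexive e ⊕ r<2N) (solve (N ∷ X ∷ q ∷ r ∷ []))) ,
      (- (+ 2 * (X - N * q)) ≤ᶻ N ∋ lin 0 (ℤ.≤-reflexive (sym e) ⊕ 0≤r)
        (solve (N ∷ X ∷ q ∷ r ∷ [])))

square : ∀ a → a ≡ + 0 ⊎ + 1 ≤ᶻ a * a
square (+ 0) = inj₁ refl
square +[1+ n ] = inj₂ (+≤+ (ℕ.s≤s ℕ.z≤n))
square -[1+ n ] = inj₂ (+≤+ (ℕ.s≤s ℕ.z≤n))

norm-positive : ∀ {β} → β ≢ 0ᵍ → + 1 ≤ᶻ re β * re β + im β * im β
norm-positive {⟪ a , b ⟫} β≢0 = go (square a) (square b)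
  where
  go : a ≡ + 0 ⊎ + 1 ≤ᶻ a * a → b ≡ + 0 ⊎ + 1 ≤ᶻ b * b → + 1 ≤ᶻ a * a + b * b
  go (inj₁ refl) (inj₁ refl) = ⊥-elim (β≢0 refl)
  go (inj₁ refl) (inj₂ q) = lin 0 q (solve (b ∷ []))
  go (inj₂ p) (inj₁ refl) = lin 0 p (solve (a ∷ []))
  go (inj₂ p) (inj₂ q) = lin 1 (p ⊕ q) (solve (a ∷ b ∷ []))

-- `X` and `Y` are the coordinates of x times the conjugate of β, and `N` is the norm of β. Hence ξ
-- is 2m times the conjugate of β, and βξ = 2Nm.
module Division (a b p q k l : ℤ) where
  β x m ξ : ℤ[i]
  N X Y : ℤ
  β = ⟪ a , b ⟫
  x = ⟪ p , q ⟫
  N = a * a + b * b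
  X = p * a + q * b
  Y = q * a - p * b
  m = x -ᵍ (β *ᵍ ⟪ k , l ⟫)
  ξ = ⟪ + 2 * (X - N * k) , + 2 * (Y - N * l) ⟫

  x-m : x -ᵍ m ≡ β *ᵍ ⟪ k , l ⟫
  x-m = cong₂ _+_i
    (p - (p - (a * k - b * l)) ≡ a * k - b * l ∋ solve (p ∷ a ∷ k ∷ b ∷ l ∷ []))
    (q - (q - (a * l + b * k)) ≡ a * l + b * k ∋ solve (q ∷ a ∷ l ∷ b ∷ k ∷ []))
  β*ξ : β *ᵍ ξ ≡ ⟪ N * re (twice m) , N * im (twice m) ⟫
  β*ξ = cong₂ _+_i
    (a * (+ 2 * (p * a + q * b - (a * a + b * b) * k))
      - b * (+ 2 * (q * a - p * b - (a * a + b * b) * l))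
      ≡ (a * a + b * b) * (+ 2 * (p - (a * k - b * l))) ∋ solve (a ∷ p ∷ q ∷ b ∷ k ∷ l ∷ []))
    (a * (+ 2 * (q * a - p * b - (a * a + b * b) * l))
      + b * (+ 2 * (p * a + q * b - (a * a + b * b) * k))
      ≡ (a * a + b * b) * (+ 2 * (q - (a * l + b * k))) ∋ solve (a ∷ q ∷ p ∷ b ∷ l ∷ k ∷ []))
  τβ*ξ : τ β *ᵍ ξ ≡ ⟪ N * re (twice (τ m)) , N * im (twice (τ m)) ⟫
  τβ*ξ = cong₂ _+_i
    ((a - b) * (+ 2 * (p * a + q * b - (a * a + b * b) * k))
      - (a + b) * (+ 2 * (q * a - p * b - (a * a + b * b) * l))
        ≡ (a * a + b * b) * (+ 2 * (p - (a * k - b * l) - (q - (a * l + b * k)))) ∋ solve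
          (a ∷ b ∷ p ∷ q ∷ k ∷ l ∷ []))
    ((a - b) * (+ 2 * (q * a - p * b - (a * a + b * b) * l))
      + (a + b) * (+ 2 * (p * a + q * b - (a * a + b * b) * k))
        ≡ (a * a + b * b) * (+ 2 * (p - (a * k - b * l) + (q - (a * l + b * k)))) ∋ solve
          (a ∷ b ∷ q ∷ p ∷ l ∷ k ∷ []))

-- Division with rounding to the nearest Gaussian integer: the remainder lies in the square centred
-- at 0 with vertices β(±1 ± i)/2.
remainder : ∀ β x → β ≢ 0ᵍ → ∃[ m ] β ∣ᵍ (x -ᵍ m) ×
  (∀ {K} → Sup K (τ β) → Sup K (twice m)) × (∀ {K} → Sup K (τ (τ β)) → Sup K (twice (τ m)))
remainder ⟪ a , b ⟫ ⟪ p , q ⟫ β≢0 = go (round X₀ N₀ 1≤N) (round Y₀ N₀ 1≤N)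
  where
  N₀ X₀ Y₀ : ℤ
  N₀ = a * a + b * b
  X₀ = p * a + q * b
  Y₀ = q * a - p * b
  1≤N : + 1 ≤ᶻ N₀
  1≤N = norm-positive {⟪ a , b ⟫} β≢0
  go : ∃[ k ] + 2 * (X₀ - N₀ * k) ≤ᶻ N₀ × - (+ 2 * (X₀ - N₀ * k)) ≤ᶻ N₀ →
       ∃[ l ] + 2 * (Y₀ - N₀ * l) ≤ᶻ N₀ × - (+ 2 * (Y₀ - N₀ * l)) ≤ᶻ N₀ → _
  go (k , X≤ , -X≤) (l , Y≤ , -Y≤) = m , (⟪ k , l ⟫ , x-m) ,
    (λ {K} h → Sup-cancel {K} {N} {twice m} 1≤N
      (subst (Sup (N * K)) β*ξ (Sup-*ᵍ {K} {N} {ξ} ξ-Sup β h))) ,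
    (λ {K} h → Sup-cancel {K} {N} {twice (τ m)} 1≤N
      (subst (Sup (N * K)) τβ*ξ (Sup-*ᵍ {K} {N} {ξ} ξ-Sup (τ β) h)))
    where
    open Division a b p q k l
    ξ-Sup : Sup N ξ
    ξ-Sup = sup X≤ -X≤ Y≤ -Y≤

-- Points near the boundary of the octagon.

-- The hypothesis says dk > d(c - 1), and no multiple of d lies strictly between d(c - 1) and dc.
multiple-gap : ∀ {d c k} → + 0 ≤ᶻ d → d * c - d + + 1 ≤ᶻ d * k → d * c ≤ᶻ d * k
multiple-gap {d} {c} {k} 0≤d h = by-cases (dichotomy c k)
  (λ c≤k → *-mono {d} {c} {k} 0≤d c≤k)
  (λ k<c → absurd 0 (h ⊕ *-mono {d} {k + + 1} {c} 0≤d k<c) (solve (d ∷ c ∷ k ∷ [])))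

-- The point z = (W − d) + qi is close to the boundary of the octagon. Subtracting a + bi from it asks
-- for three lower bounds on q, subtracting b − ai for three upper bounds. If one of the lower bounds
-- fails, all upper bounds hold.
module Shift {W V U d q a b : ℤ} (2≤d : + 2 ≤ᶻ d) (W+d≤V : W + d ≤ᶻ V) (V+d≤2W : V + d ≤ᶻ + 2 * W)
  (U≤ : U + + 2 ≤ᶻ V) (≤U : V ≤ᶻ U + + 3)
  (q≤ : q ≤ᶻ V - W) (-q≤ : - q ≤ᶻ V - W)
  (q-gap : V - W - d + + 1 ≤ᶻ q → V - W ≤ᶻ q) (-q-gap : V - W - d + + 1 ≤ᶻ - q → V - W ≤ᶻ - q)
  (p+q≤ : W - d + q ≤ᶻ U) (p-q≤ : W - d - q ≤ᶻ U)
  (0≤a : + 0 ≤ᶻ a) (0≤b : + 0 ≤ᶻ b) (a≤U : a ≤ᶻ U) (b≤U : b ≤ᶻ U) (a+b≤ : a + b ≤ᶻ + 2 * W - + 3)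
  where

  p : ℤ
  p = W - d

  Inside : ℤ[i] → Set
  Inside z = Sup (W - + 2) z × Sup U (τ z)

  -- The hypotheses are the three lower bounds on q. The other five inequalities follow from the
  -- standing assumptions.
  first : b - q ≤ᶻ W - + 2 → a + b - p - q ≤ᶻ U → p - a + b - q ≤ᶻ U → Inside ⟪ p - a , q - b ⟫
  first h₁ h₂ h₃ =
    sup
      (W - d - a ≤ᶻ W - + 2 ∋ lin 0 (0≤a ⊕ 2≤d) (solve (W ∷ d ∷ a ∷ [])))
      (- (W - d - a) ≤ᶻ W - + 2 ∋ lin 0 (a≤U ⊕ U≤ ⊕ V+d≤2W) (solve (W ∷ d ∷ a ∷ U ∷ V ∷ [])))
      (lin 0 (q≤ ⊕ V+d≤2W ⊕ 2≤d ⊕ 0≤b) (solve (W ∷ q ∷ b ∷ V ∷ d ∷ [])))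
      (lin 0 h₁ (solve (W ∷ q ∷ b ∷ []))) ,
    sup
      (lin 0 h₃ (U - (W - d - a - (q - b)) ≡ U - (W - d - a + b - q) + + 0 ∋
        solve (U ∷ W ∷ d ∷ a ∷ q ∷ b ∷ [])))
      (- (W - d - a - (q - b)) ≤ᶻ U ∋
        lin 0 (a≤U ⊕ q≤ ⊕ V+d≤2W ⊕ 0≤b) (solve (U ∷ W ∷ d ∷ a ∷ q ∷ b ∷ V ∷ [])))
      (W - d - a + (q - b) ≤ᶻ U ∋ lin 0 (p+q≤ ⊕ 0≤a ⊕ 0≤b) (solve (U ∷ W ∷ d ∷ a ∷ q ∷ b ∷ [])))
      (lin 0 h₂ (U - - (W - d - a + (q - b)) ≡ U - (a + b - (W - d) - q) + + 0 ∋
        solve (U ∷ W ∷ d ∷ a ∷ q ∷ b ∷ [])))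

  second : q + a ≤ᶻ W - + 2 → b - p + q + a ≤ᶻ U → p - b + q + a ≤ᶻ U → Inside ⟪ p - b , q + a ⟫
  second h₁ h₂ h₃ =
    sup
      (W - d - b ≤ᶻ W - + 2 ∋ lin 0 (0≤b ⊕ 2≤d) (solve (W ∷ d ∷ b ∷ [])))
      (- (W - d - b) ≤ᶻ W - + 2 ∋ lin 0 (b≤U ⊕ U≤ ⊕ V+d≤2W) (solve (W ∷ d ∷ b ∷ U ∷ V ∷ [])))
      (lin 0 h₁ (solve (W ∷ q ∷ a ∷ [])))
      (lin 0 (-q≤ ⊕ V+d≤2W ⊕ 2≤d ⊕ 0≤a) (solve (W ∷ q ∷ a ∷ V ∷ d ∷ []))) ,
    sup
      (W - d - b - (q + a) ≤ᶻ U ∋ lin 0 (p-q≤ ⊕ 0≤a ⊕ 0≤b) (solve (U ∷ W ∷ d ∷ b ∷ q ∷ a ∷ [])))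
      (lin 0 h₂ (U - - (W - d - b - (q + a)) ≡ U - (b - (W - d) + q + a) + + 0 ∋
        solve (U ∷ W ∷ d ∷ b ∷ q ∷ a ∷ [])))
      (lin 0 h₃ (U - (W - d - b + (q + a)) ≡ U - (W - d - b + q + a) + + 0 ∋
        solve (U ∷ W ∷ d ∷ b ∷ q ∷ a ∷ [])))
      (- (W - d - b + (q + a)) ≤ᶻ U ∋
        lin 0 (b≤U ⊕ -q≤ ⊕ V+d≤2W ⊕ 0≤a) (solve (U ∷ W ∷ d ∷ b ∷ q ∷ a ∷ V ∷ [])))

  Outcome : Set
  Outcome = Inside ⟪ p - a , q - b ⟫ ⊎ Inside ⟪ p - b , q + a ⟫

  case₁ : W - + 2 + + 1 ≤ᶻ b - q → Outcome
  case₁ h = inj₂ (second (lin 0 (h ⊕ a+b≤) (solve (W ∷ q ∷ a ∷ b ∷ []))) h₂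
    (W - d - b + q + a ≤ᶻ U ∋ lin 1 (h ⊕ a≤U ⊕ 2≤d) (solve (U ∷ W ∷ d ∷ b ∷ q ∷ a ∷ []))))
    where
    h₂ : b - p + q + a ≤ᶻ U
    h₂ = by-cases (dichotomy (b - p + q + a) U)
      (λ g → g)
      -- Otherwise q > V - W - d, which `q-gap` raises to q ≥ V - W. This contradicts `h` and b ≤ U.
      (λ g → absurd 0 (q-gap (lin 0 (g ⊕ a+b≤ ⊕ ≤U)
        (q - (V - W - d + + 1) ≡ b - (W - d) + q + a + (+ 2 * W - + 3) + (U + + 3)
          - (U + + 1 + (a + b) + V) + + 0 ∋ solve (q ∷ V ∷ W ∷ d ∷ b ∷ a ∷ U ∷ []))) ⊕ h ⊕ b≤U ⊕ U≤)
            (solve (V ∷ W ∷ b ∷ U ∷ q ∷ [])))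

  case₂ : U + + 1 ≤ᶻ a + b - p - q → Outcome
  case₂ h = inj₂ (second (lin 0 (-q≥ ⊕ a≤U ⊕ U≤) (solve (W ∷ q ∷ a ∷ U ∷ V ∷ [])))
    (b - (W - d) + q + a ≤ᶻ U ∋ lin 2 (-q≥ ⊕ W+d≤V ⊕ W+d≤V ⊕ a+b≤ ⊕ ≤U ⊕ 2≤d)
      (solve (U ∷ b ∷ W ∷ d ∷ q ∷ a ∷ V ∷ [])))
        (lin 1 (h ⊕ a≤U ⊕ a≤U) (U - (W - d - b + q + a)
          ≡ a + b - (W - d) - q + U + U - (U + + 1 + a + a) + + 1 ∋ solve
            (U ∷ W ∷ d ∷ b ∷ q ∷ a ∷ []))))
    where
    -q≥ : V - W ≤ᶻ - q
    -- The violated bound only yields -q > V - W - d; the gap assumption closes the difference.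
    -q≥ = -q-gap (lin 0 (h ⊕ a+b≤ ⊕ ≤U)
      (- q - (V - W - d + + 1) ≡ a + b - (W - d) - q + (+ 2 * W - + 3) + (U + + 3)
        - (U + + 1 + (a + b) + V) + + 0 ∋ solve (q ∷ V ∷ W ∷ d ∷ a ∷ b ∷ U ∷ [])))

  case₃ : U + + 1 ≤ᶻ p - a + b - q → Outcome
  case₃ h = inj₂ (second (lin 1 (h ⊕ b≤U ⊕ 2≤d)
    (W - + 2 - (q + a) ≡ W - d - a + b - q + U + d - (U + + 1 + b + + 2) + + 1 ∋
      solve (W ∷ q ∷ a ∷ d ∷ b ∷ U ∷ [])))
        (lin 1 (h ⊕ b≤U ⊕ b≤U) (U - (b - (W - d) + q + a)
          ≡ W - d - a + b - q + U + U - (U + + 1 + b + b) + + 1 ∋ solve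
            (U ∷ b ∷ W ∷ d ∷ q ∷ a ∷ [])))
    (lin 1 (h ⊕ p+q≤ ⊕ p-q≤) (U - (W - d - b + q + a)
      ≡ W - d - a + b - q + U + U - (U + + 1 + (W - d + q) + (W - d - q)) + + 1 ∋ solve
        (U ∷ W ∷ d ∷ b ∷ q ∷ a ∷ []))))

  outcome : Outcome
  outcome with dichotomy (b - q) (W - + 2) | dichotomy (a + b - p - q) U
             | dichotomy (p - a + b - q) U
  ... | inj₁ h₁ | inj₁ h₂ | inj₁ h₃ = inj₁ (first h₁ h₂ h₃)
  ... | inj₂ h₁ | _       | _       = case₁ h₁
  ... | inj₁ _  | inj₂ h₂ | _       = case₂ h₂
  ... | inj₁ _  | inj₁ _  | inj₂ h₃ = case₃ h₃

-- The shape, up to a unit, that z or (1 + i)z has if z is not in the n-th Motzkin set although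
-- M(z) < W = w n and L(z) < V = w (n + 1).
data Boundary (W V : ℤ) : ℤ[i] → Set where
  here : ∀ d c k → + 1 ≤ᶻ d → V ≡ W + d * c → W + d ≤ᶻ V → V + d ≤ᶻ + 2 * W →
    Boundary W V ⟪ W - d , d * k ⟫
  turn : ∀ {z} → Boundary W V z → Boundary W V (rot z)

Odd-rot : ∀ {z} → Odd z → Odd (rot z)
Odd-rot {⟪ a , b ⟫} (c , e) = c - b , trans (- b + a ≡ a + b - + 2 * b ∋ solve (b ∷ a ∷ []))
  (trans (cong (λ s → s - + 2 * b) e)
    (+ 2 * c + + 1 - + 2 * b ≡ + 2 * (c - b) + + 1 ∋ solve (c ∷ b ∷ [])))

rot--ᵍ : ∀ y z → rot (y -ᵍ z) ≡ rot y -ᵍ rot z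
rot--ᵍ ⟪ a , b ⟫ ⟪ c , d ⟫ = cong₂ _+_i
  (- (b - d) ≡ - b - - d ∋ solve (b ∷ d ∷ []))
  (solve (a ∷ c ∷ []))

-- An odd u makes z - βu odd when β is odd and z is even, so that membership in the Motzkin set
-- reduces to the two bounds.
Shiftable : (W U : ℤ) → ℤ[i] → ℤ[i] → Set
Shiftable W U β z = ∃[ u ] Odd u × Sup (W - + 2) (z -ᵍ (β *ᵍ u)) × Sup U (τ (z -ᵍ (β *ᵍ u)))

Shiftable-rot : ∀ {W U β z} → Shiftable W U β z → Shiftable W U β (rot z)
Shiftable-rot {W} {U} {β} {z} (u , u-odd , s , t) = rot u , Odd-rot {u} u-odd ,
  subst (Sup _) e (Sup-rot s) , subst (λ y → Sup U (τ y)) e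
    (subst (Sup U) (sym (τ-rot y)) (Sup-rot t))
  where
  y : ℤ[i]
  y = z -ᵍ (β *ᵍ u)
  e : rot y ≡ rot z -ᵍ (β *ᵍ rot u)
  e = trans (rot--ᵍ z (β *ᵍ u)) (cong (λ v → rot z -ᵍ v) (sym (*ᵍ-rot β u)))

Shiftable-rotˡ : ∀ {W U β z} → Shiftable W U β z → Shiftable W U (rot β) z
Shiftable-rotˡ {W} {U} {β} {z} (u , u-odd , s , t) = rot (rot (rot u)) ,
  Odd-rot {rot (rot u)} (Odd-rot {rot u} (Odd-rot {u} u-odd)) ,
  subst (λ y → Sup (W - + 2) (z -ᵍ y)) (e β u) s , subst (λ y → Sup U (τ (z -ᵍ y))) (e β u) t
  where
  e : ∀ β u → β *ᵍ u ≡ rot β *ᵍ rot (rot (rot u))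
  e ⟪ a , b ⟫ ⟪ c , d ⟫ = cong₂ _+_i
    (a * c - b * d ≡ - b * - (- d) - a * - c ∋ solve (a ∷ c ∷ b ∷ d ∷ []))
    (a * d + b * c ≡ - b * - c + a * - (- d) ∋ solve (a ∷ d ∷ b ∷ c ∷ []))

-- Rotating z and β reduces this to the module `Shift`. `U` is V - 2 or V - 3: the first value
-- serves for m itself, the second for (1 + i)m, where M and L exchange roles.
shift : ∀ {W V U z} → U + + 2 ≤ᶻ V → V ≤ᶻ U + + 3 → Boundary W V z → Sup (W - + 2) z → Sup U (τ z) →
  ∀ β → Sup U β → Sup (+ 2 * W - + 3) (τ β) → Shiftable W U β z
shift {W} {U = U} U≤ ≤U (turn {z} y) s t β b b′ = Shiftable-rot {W} {U} {β} {z}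
  (shift U≤ ≤U y (Sup-rot⁻¹ s) (Sup-rot⁻¹ (subst (Sup _) (τ-rot z) t)) β b b′)
shift {W} {V} {U} U≤ ≤U (here d c k 1≤d V≡ W+d≤V V+d≤2W) (sup p≤ _ _ _) (sup p-q≤ _ p+q≤ _) =
  rot-induction P step base
  where
  P : ℤ[i] → Set
  P β = Sup U β → Sup (+ 2 * W - + 3) (τ β) → Shiftable W U β ⟪ W - d , d * k ⟫
  step : ∀ β → P β → P (rot β)
  step β h b b′ = Shiftable-rotˡ {W} {U} {β} {⟪ W - d , d * k ⟫}
    (h (Sup-rot⁻¹ b) (Sup-rot⁻¹ (subst (Sup _) (τ-rot β) b′)))
  0≤d : + 0 ≤ᶻ d
  0≤d = lin 1 1≤d (solve (d ∷ []))
  gap : ∀ j → V - W - d + + 1 ≤ᶻ d * j → V - W ≤ᶻ d * j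
  -- V - W = dc, so a multiple of d above V - W - d is at least V - W.
  gap j h = lin 0 (multiple-gap {d} {c} {j} 0≤d
    (lin 0 (h ⊕ ℤ.≤-reflexive (sym V≡)) (solve (d ∷ j ∷ c ∷ V ∷ W ∷ [])))
                    ⊕ ℤ.≤-reflexive V≡) (solve (d ∷ j ∷ V ∷ W ∷ c ∷ []))
  bound : ∀ j → W - d + d * j ≤ᶻ U → d * j ≤ᶻ V - W
  -- Here dj ≤ U - W + d < V - W + d = d(c + 1), hence dj ≤ dc.
  bound j h = by-cases (dichotomy (d * j) (V - W))
      (λ g → g)
      (λ g → absurd 1 (multiple-gap {d} {c + + 1} {j} 0≤d
        (lin 0 (g ⊕ ℤ.≤-reflexive (sym V≡)) (solve (d ∷ j ∷ c ∷ V ∷ W ∷ [])))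
                    ⊕ h ⊕ U≤ ⊕ ℤ.≤-reflexive V≡) (solve (d ∷ c ∷ W ∷ j ∷ U ∷ V ∷ [])))
  neg : - (d * k) ≡ d * (- k)
  neg = solve (d ∷ k ∷ [])
  base : ∀ a b → + 0 ≤ᶻ a → + 0 ≤ᶻ b → P ⟪ a , b ⟫
  base a b 0≤a 0≤b (sup a≤U _ b≤U _) (sup _ _ a+b≤ _) = conclude outcome
    where
    open Shift {W} {V} {U} {d} {d * k} {a} {b} (lin 0 p≤ (solve (d ∷ W ∷ []))) W+d≤V V+d≤2W U≤ ≤U
      (bound k p+q≤) (subst (_≤ᶻ V - W) (sym neg)
        (bound (- k) (lin 0 p-q≤ (U - (W - d + d * - k) ≡ U - (W - d - d * k) + + 0 ∋
          solve (U ∷ W ∷ d ∷ k ∷ [])))))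
      (gap k) (subst (λ y → V - W - d + + 1 ≤ᶻ y → V - W ≤ᶻ y) (sym neg) (gap (- k)))
      p+q≤ p-q≤ 0≤a 0≤b a≤U b≤U a+b≤
    e₁ : ∀ a b p q → ⟪ p - a , q - b ⟫ ≡ ⟪ p , q ⟫ -ᵍ (⟪ a , b ⟫ *ᵍ 1ᵍ)
    e₁ a b p q = cong₂ _+_i
      (p - a ≡ p - (a * + 1 - b * + 0) ∋ solve (p ∷ a ∷ b ∷ []))
      (q - b ≡ q - (a * + 0 + b * + 1) ∋ solve (q ∷ b ∷ a ∷ []))
    e₂ : ∀ a b p q → ⟪ p - b , q + a ⟫ ≡ ⟪ p , q ⟫ -ᵍ (⟪ a , b ⟫ *ᵍ (-ᵍ iᵍ))
    e₂ a b p q = cong₂ _+_i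
      (p - b ≡ p - (a * - (+ 0) - b * - (+ 1)) ∋ solve (p ∷ b ∷ a ∷ []))
      (q + a ≡ q - (a * - (+ 1) + b * - (+ 0)) ∋ solve (q ∷ a ∷ b ∷ []))
    conclude : Outcome → Shiftable W U ⟪ a , b ⟫ ⟪ W - d , d * k ⟫
    conclude (inj₁ (s , t)) = 1ᵍ , (+ 0 , refl) ,
      subst (Sup (W - + 2)) (e₁ a b (W - d) (d * k)) s , subst (λ y → Sup U (τ y))
        (e₁ a b (W - d) (d * k)) t
    conclude (inj₂ (s , t)) = -ᵍ iᵍ , (-[1+ 0 ] , refl) ,
      subst (Sup (W - + 2)) (e₂ a b (W - d) (d * k)) s , subst (λ y → Sup U (τ y))
        (e₂ a b (W - d) (d * k)) t

-- Octagons as bounds for moduli and remainders.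

record Octagon (W V : ℤ) (z : ℤ[i]) : Set where
  constructor octagon
  field
    max≤ : Sup (W - + 2) z
    sum≤ : Sup (V - + 3) (τ z)

Octagon-mono : ∀ {W V W′ V′ z} → W ≤ᶻ W′ → V ≤ᶻ V′ → Octagon W V z → Octagon W′ V′ z
Octagon-mono {W} {V} {W′} {V′} p q (octagon s t) = octagon
  (Sup-mono (W - + 2 ≤ᶻ W′ - + 2 ∋ lin 0 p (solve (W′ ∷ W ∷ []))) s)
  (Sup-mono (V - + 3 ≤ᶻ V′ - + 3 ∋ lin 0 q (solve (V′ ∷ V ∷ []))) t)

Octagon-rot : ∀ {W V z} → Octagon W V z → Octagon W V (rot z)
Octagon-rot {z = z} (octagon s t) = octagon (Sup-rot s) (subst (Sup _) (sym (τ-rot z)) (Sup-rot t))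

Octagon-0 : ∀ {W V} → + 2 ≤ᶻ W → + 3 ≤ᶻ V → Octagon W V 0ᵍ
Octagon-0 {W} {V} p q = octagon (sup p′ p′ p′ p′) (sup q′ q′ q′ q′)
  where
  p′ = (+ 0 ≤ᶻ W - + 2 ∋ lin 0 p (solve (W ∷ [])))
  q′ = (+ 0 - + 0 ≤ᶻ V - + 3 ∋ lin 0 q (solve (V ∷ [])))

Octagon-τ : ∀ {W V z} → Octagon W V z → Octagon V (+ 2 * W) (τ z)
Octagon-τ {W} {V} {z} (octagon s t) = octagon
  (Sup-mono (V - + 3 ≤ᶻ V - + 2 ∋ lin 1 (ℤ.≤-refl {V}) (solve (V ∷ []))) t)
  (Sup-mono (+ 2 * (W - + 2) ≤ᶻ + 2 * W - + 3 ∋ lin 1 (ℤ.≤-refl {W}) (solve (W ∷ []))) (Sup-ττ s))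

Octagon-odd : ∀ {W V v z} → V ≡ + 2 * v → Odd z → Sup (W - + 2) z →
  Sup (V - + 2) (τ z) → Octagon W V z
Octagon-odd {v = v} {z} refl o s t = octagon s (Odd-Sup {z} {v} o t)

-- For x = (1 + i)(β − 1)/2 and m ≡ x mod β, the number 2m + 1 + i is a multiple βs of β with both
-- coordinates of s odd, hence nonzero.
Octagon-if-covered : ∀ {W V} {M : ℤ[i] → Set} → (∀ {m} → M m → Octagon W V m) →
  ∀ β → Odd β → M ↠mod β → Octagon V (+ 2 * W) β
Octagon-if-covered {W} {V} M⊆ ⟪ a , b ⟫ (c , a+b≡) cover =
  let (m , m∈ , q , e) = cover ⟪ c - b , c ⟫ in go m (M⊆ m∈) q (cong re e) (cong im e)
  where
  1-2k≢0 : ∀ k → + 1 - + 2 * k ≢ + 0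
  1-2k≢0 k e = odd≢even {+ 0} {k} (lin≡ e (solve (k ∷ [])))
  go : ∀ m → Octagon W V m → ∀ q → c - b - re m ≡ a * re q - b * im q → c - im m
    ≡ a * im q + b * re q →
    Octagon V (+ 2 * W) ⟪ a , b ⟫
  go ⟪ x , y ⟫ (octagon (sup p₁ p₂ p₃ p₄) (sup q₁ q₂ q₃ q₄)) ⟪ k , l ⟫ e₁ e₂ = octagon
    (Sup-ττ⁻¹ {V - + 2} {β} (Sup-mono
      (+ 2 * V - + 4 ≤ᶻ + 2 * (V - + 2) + + 1 ∋ lin 1 (ℤ.≤-refl {V}) (solve (V ∷ [])))
        (τ-Sup-by-multiple s (1-2k≢0 k) (1-2k≢0 l) (τ β)
          (subst (Sup _) (τ-*ᵍ β s) (subst (λ v → Sup (+ 2 * V - + 4) (τ v)) e (sup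
      (lin 2 (q₁ ⊕ q₁) (+ 2 * V - + 4 - (+ 2 * x + + 1 - (+ 2 * y + + 1))
        ≡ V - + 3 + (V - + 3) - (x - y + (x - y)) + + 2 ∋ solve (V ∷ x ∷ y ∷ [])))
      (lin 2 (q₂ ⊕ q₂) (+ 2 * V - + 4 - - (+ 2 * x + + 1 - (+ 2 * y + + 1))
        ≡ V - + 3 + (V - + 3) - (- (x - y) + - (x - y)) + + 2 ∋ solve (V ∷ x ∷ y ∷ [])))
      (lin 0 (q₃ ⊕ q₃) (+ 2 * V - + 4 - (+ 2 * x + + 1 + (+ 2 * y + + 1))
        ≡ V - + 3 + (V - + 3) - (x + y + (x + y)) + + 0 ∋ solve (V ∷ x ∷ y ∷ [])))
      (lin 4 (q₄ ⊕ q₄) (+ 2 * V - + 4 - - (+ 2 * x + + 1 + (+ 2 * y + + 1))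
        ≡ V - + 3 + (V - + 3) - (- (x + y) + - (x + y)) + + 4 ∋ solve (V ∷ x ∷ y ∷ [])))))))))
    (τ-Sup-by-multiple s (1-2k≢0 k) (1-2k≢0 l) β (subst (Sup (+ 2 * W - + 3)) e (sup
      (lin 0 (p₁ ⊕ p₁) (solve (W ∷ x ∷ [])))
      (lin 2 (p₂ ⊕ p₂) (solve (W ∷ x ∷ [])))
      (lin 0 (p₃ ⊕ p₃) (solve (W ∷ y ∷ [])))
      (lin 2 (p₄ ⊕ p₄) (solve (W ∷ y ∷ []))))))
    where
    β s : ℤ[i]
    β = ⟪ a , b ⟫
    s = ⟪ + 1 - + 2 * k , + 1 - + 2 * l ⟫
    e : ⟪ + 2 * x + + 1 , + 2 * y + + 1 ⟫ ≡ β *ᵍ s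
    e = cong₂ _+_i
      (lin≡ (cong₂ _+_ (sym a+b≡) (cong₂ _+_ (sym e₁) (sym e₁)))
        (+ 2 * x + + 1 - (a * (+ 1 - + 2 * k) - b * (+ 1 - + 2 * l))
          ≡ + 2 * c + + 1 + (a * k - b * l + (a * k - b * l))
            - (a + b + (c - b - x + (c - b - x))) ∋ solve (x ∷ a ∷ k ∷ b ∷ l ∷ c ∷ [])))
      (lin≡ (cong₂ _+_ (sym a+b≡) (cong₂ _+_ (sym e₂) (sym e₂)))
        (+ 2 * y + + 1 - (a * (+ 1 - + 2 * l) + b * (+ 1 - + 2 * k))
          ≡ + 2 * c + + 1 + (a * l + b * k + (a * l + b * k)) - (a + b + (c - y + (c - y))) ∋ solve
            (y ∷ a ∷ l ∷ b ∷ k ∷ c ∷ [])))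

-- From 2M(m) ≤ L(β) ≤ 2W - 3 integrality gives M(m) ≤ W - 2; moreover L(m) ≤ M(β) ≤ V - 2.
small-remainder : ∀ {W V} β x → β ≢ 0ᵍ → Octagon V (+ 2 * W) β →
  ∃[ m ] β ∣ᵍ (x -ᵍ m) × Sup (W - + 2) m × Sup (V - + 2) (τ m)
small-remainder {W} {V} β x β≢0 (octagon s t) = let (m , d , f , g) = remainder β x β≢0 in m , d ,
  Sup-twice⁻¹ (Sup-mono (+ 2 * W - + 3 ≤ᶻ + 2 * (W - + 2) + + 1 ∋
    lin 0 (ℤ.≤-refl {W}) (solve (W ∷ []))) (f t)) ,
  Sup-twice⁻¹ (Sup-mono (+ 2 * (V - + 2) ≤ᶻ + 2 * (V - + 2) + + 1 ∋
    lin 1 (ℤ.≤-refl {V}) (solve (V ∷ []))) (g (Sup-ττ s)))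

-- M(z) is exactly W - 1 here, so d = 1 works, which divides everything.
at-edge : ∀ {W V z} → W + + 1 ≤ᶻ V → V + + 1 ≤ᶻ + 2 * W → Sup (W - + 1) z → Exceeds (W - + 2) z →
  Boundary W V z
at-edge {W} {V} {⟪ a , b ⟫} p q (sup s₁ s₂ s₃ s₄) = λ where
    (inj₁ e) → front b s₁ e
    (inj₂ (inj₁ e)) → subst (λ z → Boundary W V z)
      (cong₂ _+_i (ℤ.neg-involutive a) (ℤ.neg-involutive b)) (turn (turn (front (- b) s₂ e)))
    (inj₂ (inj₂ (inj₁ e))) → subst (λ v → Boundary W V ⟪ v , b ⟫) (ℤ.neg-involutive a)
      (turn (front (- a) s₃ e))
    (inj₂ (inj₂ (inj₂ e))) → subst (λ z → Boundary W V z)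
      (cong₂ _+_i (ℤ.neg-involutive a) (ℤ.neg-involutive b)) (turn (turn (turn (front a s₄ e))))
  where
  front : ∀ {x} y → x ≤ᶻ W - + 1 → W - + 2 + + 1 ≤ᶻ x → Boundary W V ⟪ x , y ⟫
  front {x} y h₁ h₂ = subst (λ z → Boundary W V z)
    (cong₂ _+_i (ℤ.≤-antisym (W - + 1 ≤ᶻ x ∋ lin 0 h₂ (solve (x ∷ W ∷ []))) h₁) (ℤ.*-identityˡ y))
    (here (+ 1) (V - W) y ℤ.≤-refl (solve (V ∷ W ∷ [])) p q)

rot-twice : ∀ z → rot (twice z) ≡ twice (rot z)
rot-twice ⟪ a , b ⟫ = cong₂ _+_i (- (+ 2 * b) ≡ + 2 * - b ∋ solve (b ∷ [])) refl

-- W, V and d double while c and k stay; this is how values d > 1 arise.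
Boundary-twice : ∀ {W V z} → Boundary W V z → Boundary (+ 2 * W) (+ 2 * V) (twice z)
Boundary-twice {W} {V} (here d c k 1≤d V≡ p q) = subst (λ z → Boundary (+ 2 * W) (+ 2 * V) z)
  (cong₂ _+_i
    (+ 2 * W - + 2 * d ≡ + 2 * (W - d) ∋ solve (W ∷ d ∷ []))
    (+ 2 * d * k ≡ + 2 * (d * k) ∋ solve (d ∷ k ∷ [])))
  (here (+ 2 * d) c k (+ 1 ≤ᶻ + 2 * d ∋ lin 1 (1≤d ⊕ 1≤d) (solve (d ∷ [])))
    (lin≡ (cong₂ _+_ V≡ V≡) (+ 2 * V - (+ 2 * W + + 2 * d * c) ≡ V + V - (W + d * c + (W + d * c)) ∋
      solve (V ∷ W ∷ d ∷ c ∷ [])))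
    (+ 2 * W + + 2 * d ≤ᶻ + 2 * V ∋ lin 0 (p ⊕ p) (solve (V ∷ W ∷ d ∷ [])))
      (+ 2 * V + + 2 * d ≤ᶻ + 2 * (+ 2 * W) ∋ lin 0 (q ⊕ q) (solve (W ∷ V ∷ d ∷ []))))
Boundary-twice {W} {V} (turn {z} b) =
  subst (λ z → Boundary (+ 2 * W) (+ 2 * V) z) (rot-twice z) (turn (Boundary-twice b))

Boundary-ττ : ∀ {W V z} → Boundary W V z → Boundary (+ 2 * W) (+ 2 * V) (τ (τ z))
Boundary-ττ {z = z} b = subst (λ z → Boundary _ _ z) (sym (ττ z)) (turn (Boundary-twice b))

-- If it is (1 + i)m that has the boundary shape, m and β are both multiplied by 1 + i. The u found
-- there serves for m as well, since 2M(m - βu) ≤ 2W - 3 gives M(m - βu) ≤ W - 2.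
Boundary-shiftable : ∀ {W V β m} → Boundary W V m ⊎ Boundary V (+ 2 * W) (τ m) →
  Octagon V (+ 2 * W) β → Sup (W - + 2) m → Sup (V - + 2) (τ m) → Shiftable W (V - + 2) β m
Boundary-shiftable {W} {V} {β} {m} (inj₁ b) (octagon s t) p q =
  shift (V - + 2 + + 2 ≤ᶻ V ∋ lin 0 (ℤ.≤-refl {V}) (solve (V ∷ [])))
    (V ≤ᶻ V - + 2 + + 3 ∋ lin 1 (ℤ.≤-refl {V}) (solve (V ∷ []))) b p q β s t
Boundary-shiftable {W} {V} {β} {m} (inj₂ b) (octagon s t) p q = go
  (shift (+ 2 * W - + 3 + + 2 ≤ᶻ + 2 * W ∋ lin 1 (ℤ.≤-refl {W}) (solve (W ∷ [])))
    (+ 2 * W ≤ᶻ + 2 * W - + 3 + + 3 ∋ lin 0 (ℤ.≤-refl {W}) (solve (W ∷ []))) b q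
    (Sup-mono (+ 2 * (W - + 2) ≤ᶻ + 2 * W - + 3 ∋ lin 1 (ℤ.≤-refl {W}) (solve (W ∷ []))) (Sup-ττ p))
      (τ β) t
    (Sup-mono (+ 2 * (V - + 2) ≤ᶻ + 2 * V - + 3 ∋ lin 1 (ℤ.≤-refl {V}) (solve (V ∷ [])))
      (Sup-ττ s)))
  where
  go : Shiftable V (+ 2 * W - + 3) (τ β) (τ m) → Shiftable W (V - + 2) β m
  go (u , o , s′ , t′) = u , o ,
    Sup-ττ⁻¹ (Sup-mono (+ 2 * W - + 3 ≤ᶻ + 2 * (W - + 2) + + 1 ∋
      lin 0 (ℤ.≤-refl {W}) (solve (W ∷ []))) (subst (λ v → Sup (+ 2 * W - + 3) (τ v)) e t′)) ,
    subst (Sup (V - + 2)) e s′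
    where
    e : τ m -ᵍ (τ β *ᵍ u) ≡ τ (m -ᵍ (β *ᵍ u))
    e = trans (cong (λ v → τ m -ᵍ v) (sym (τ-*ᵍ β u))) (sym (τ--ᵍ m (β *ᵍ u)))

-- The sequence `w`.

w-step : ∀ n → w (2 ℕ.+ n) ≡ 2 ℕ.* w n
w-step n = trans
  (cong₂ (λ r q → (3 ℕ.+ r) ℕ.* 2 ℕ.^ q)
    (trans (cong (ℕ._% 2) (ℕ.+-comm 2 n)) (ℕ.[m+n]%n≡m%n n 2))
    (ℕ.m/n≡1+[m∸n]/n {2 ℕ.+ n} {2} (ℕ.s≤s (ℕ.s≤s ℕ.z≤n))))
  (x∙yz≈y∙xz ℕ.*-commutativeSemigroup (3 ℕ.+ n ℕ.% 2) 2 (2 ℕ.^ (n ℕ./ 2)))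

-- Opacity keeps `w` from unfolding inside linear arithmetic; `W₀`, `W₁` and `W-step` determine the
-- sequence.
opaque
  W : ℕ → ℤ
  W n = + w n

  W≡w : ∀ n → W n ≡ + w n
  W≡w n = refl

  W₀ : W 0 ≡ + 3
  W₀ = refl

  W₁ : W 1 ≡ + 4
  W₁ = refl

  W-step : ∀ n → W (2 ℕ.+ n) ≡ + 2 * W n
  W-step n = trans (cong +_ (w-step n)) (ℤ.pos-* 2 (w n))

-- The two bounds feed each other: as w (n + 2) = 2 w n, each one at n + 1 follows from the other at
-- n.
W-gap : ∀ n → W n + + 1 ≤ᶻ W (suc n) × W (suc n) + + 2 ≤ᶻ + 2 * W n
W-gap 0 = go W₀ W₁
  where
  go : ∀ {a b} → a ≡ + 3 → b ≡ + 4 → a + + 1 ≤ᶻ b × b + + 2 ≤ᶻ + 2 * a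
  go refl refl = ℤ.≤-refl , ℤ.≤-refl
W-gap (suc n) = go (W-step n) (W-gap n)
  where
  go : ∀ {a b c} → c ≡ + 2 * a → a + + 1 ≤ᶻ b × b + + 2 ≤ᶻ + 2 * a →
    b + + 1 ≤ᶻ c × c + + 2 ≤ᶻ + 2 * b
  go {a} {b} refl (h , h′) = (b + + 1 ≤ᶻ + 2 * a ∋ lin 1 h′ (solve (a ∷ b ∷ []))) ,
    (+ 2 * a + + 2 ≤ᶻ + 2 * b ∋ lin 0 (h ⊕ h) (solve (b ∷ a ∷ [])))

W-mono : ∀ n → W n ≤ᶻ W (suc n)
W-mono n = go (proj₁ (W-gap n))
  where
  go : ∀ {a b} → a + + 1 ≤ᶻ b → a ≤ᶻ b
  go {a} {b} h = (a ≤ᶻ b ∋ lin 1 h (solve (b ∷ a ∷ [])))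

3≤W : ∀ n → + 3 ≤ᶻ W n
3≤W 0 = ℤ.≤-reflexive (sym W₀)
3≤W (suc n) = ℤ.≤-trans (3≤W n) (W-mono n)

-- Supplies the even bound from which `Odd-Sup` gains one.
W-even : ∀ n → ∃[ v ] W (suc n) ≡ + 2 * v
W-even 0 = + 2 , W₁
W-even (suc n) = W n , W-step n

-- The candidate sets `T n`.

-- The factor (1 + i)^v is built up by v uses of `evenᵀ`, each of which raises the level by one.
data T : ℕ → ℤ[i] → Set where
  zeroᵀ : ∀ {n} → T n 0ᵍ
  oddᵀ  : ∀ {n z} → Odd z → Octagon (W n) (W (suc n)) z → T n z
  evenᵀ : ∀ {n y} → T n y → T (suc n) (τ y)

T⇒Octagon : ∀ {n z} → T n z → Octagon (W n) (W (suc n)) z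
T⇒Octagon {n} zeroᵀ = Octagon-0 (ℤ.≤-trans (+≤+ (ℕ.m≤m+n 2 1)) (3≤W n)) (3≤W (suc n))
T⇒Octagon (oddᵀ _ o) = o
T⇒Octagon {suc n} (evenᵀ {y = y} t) =
  subst (λ v → Octagon (W (suc n)) v (τ y)) (sym (W-step n)) (Octagon-τ (T⇒Octagon t))

T-odd : ∀ {n v z} → W (suc n) ≡ + 2 * v → Odd z → Sup (W n - + 2) z →
  Sup (W (suc n) - + 2) (τ z) → T n z
T-odd {v = v} e o s t = oddᵀ o (Octagon-odd {v = v} e o s t)

T-mono : ∀ {n z} → T n z → T (suc n) z
T-mono zeroᵀ = zeroᵀ
T-mono {n} (oddᵀ o q) = oddᵀ o (Octagon-mono (W-mono n) (W-mono (suc n)) q)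
T-mono (evenᵀ t) = evenᵀ (T-mono t)

T-rot : ∀ {n z} → T n z → T n (rot z)
T-rot zeroᵀ = zeroᵀ
T-rot {z = z} (oddᵀ o q) = oddᵀ (Odd-rot {z} o) (Octagon-rot q)
T-rot (evenᵀ {y = y} t) = subst (T _) (τ-rot y) (evenᵀ (T-rot t))

T-τ⁻¹ : ∀ {n y} → T (suc n) (τ y) → T n y
T-τ⁻¹ t = go t refl
  where
  go : ∀ {n y z} → T (suc n) z → z ≡ τ y → T n y
  go zeroᵀ e = subst (T _) (τ-injective {0ᵍ} e) zeroᵀ
  go {y = y} (oddᵀ o _) refl = ⊥-elim (τ-not-Odd {y} o)
  go (evenᵀ t) e = subst (T _) (τ-injective e) t

T₀-τ : ∀ {y} → T 0 (τ y) → y ≡ 0ᵍ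
T₀-τ t = go t refl
  where
  go : ∀ {y z} → T 0 z → z ≡ τ y → y ≡ 0ᵍ
  go zeroᵀ e = sym (τ-injective {0ᵍ} e)
  go {y = y} (oddᵀ o _) refl = ⊥-elim (τ-not-Odd {y} o)

-- Level 0: zero and the units.

opaque
  unfolding W

  T₀-1 : T 0 1ᵍ
  T₀-1 = oddᵀ (+ 0 , refl)
    (octagon (sup ℤ.≤-refl ℤ.-≤+ (+≤+ ℕ.z≤n) (+≤+ ℕ.z≤n)) (sup ℤ.≤-refl ℤ.-≤+ ℤ.≤-refl ℤ.-≤+))

A₀⇒T₀ : ∀ {z} → A 0 z → T 0 z
A₀⇒T₀ (inj₁ refl) = zeroᵀ
A₀⇒T₀ (inj₂ (inj₁ refl)) = T₀-1
A₀⇒T₀ (inj₂ (inj₂ (inj₁ refl))) = T-rot (T-rot T₀-1)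
A₀⇒T₀ (inj₂ (inj₂ (inj₂ (inj₁ refl)))) = T-rot T₀-1
A₀⇒T₀ (inj₂ (inj₂ (inj₂ (inj₂ refl)))) = T-rot (T-rot (T-rot T₀-1))

sup-1 : ∀ {a} → a ≤ᶻ + 1 → - a ≤ᶻ + 1 → a ≡ + 0 ⊎ a ≡ + 1 ⊎ a ≡ -[1+ 0 ]
sup-1 {+ 0} _ _ = inj₁ refl
sup-1 {+ 1} _ _ = inj₂ (inj₁ refl)
sup-1 {+ suc (suc n)} (+≤+ (ℕ.s≤s ())) _
sup-1 { -[1+ 0 ]} _ _ = inj₂ (inj₂ refl)
sup-1 { -[1+ suc n ]} _ (+≤+ (ℕ.s≤s ()))

opaque
  unfolding W

  T₀⇒A₀ : ∀ {z} → T 0 z → A 0 z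
  T₀⇒A₀ zeroᵀ = inj₁ refl
  T₀⇒A₀ {⟪ a , b ⟫} (oddᵀ _ (octagon (sup p q r s) (sup p′ q′ r′ s′))) =
    go (sup-1 p q) (sup-1 r s) p′ q′ r′ s′
    where
    go : ∀ {a b} → a ≡ + 0 ⊎ a ≡ + 1 ⊎ a ≡ -[1+ 0 ] → b ≡ + 0 ⊎ b ≡ + 1 ⊎ b ≡ -[1+ 0 ] →
      a - b ≤ᶻ + 1 → - (a - b) ≤ᶻ + 1 → a + b ≤ᶻ + 1 → - (a + b) ≤ᶻ + 1 → A 0 ⟪ a , b ⟫
    go (inj₁ refl) (inj₁ refl) _ _ _ _ = inj₁ refl
    go (inj₁ refl) (inj₂ (inj₁ refl)) _ _ _ _ = inj₂ (inj₂ (inj₂ (inj₁ refl)))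
    go (inj₁ refl) (inj₂ (inj₂ refl)) _ _ _ _ = inj₂ (inj₂ (inj₂ (inj₂ refl)))
    go (inj₂ (inj₁ refl)) (inj₁ refl) _ _ _ _ = inj₂ (inj₁ refl)
    go (inj₂ (inj₂ refl)) (inj₁ refl) _ _ _ _ = inj₂ (inj₂ (inj₁ refl))
    go (inj₂ (inj₁ refl)) (inj₂ (inj₁ refl)) _ _ (+≤+ (ℕ.s≤s ())) _
    go (inj₂ (inj₁ refl)) (inj₂ (inj₂ refl)) (+≤+ (ℕ.s≤s ())) _ _ _
    go (inj₂ (inj₂ refl)) (inj₂ (inj₁ refl)) _ (+≤+ (ℕ.s≤s ())) _ _
    go (inj₂ (inj₂ refl)) (inj₂ (inj₂ refl)) _ _ _ (+≤+ (ℕ.s≤s ()))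

unit-inverse : ∀ {z} → A 0 z → z ≢ 0ᵍ → ∃[ q ] 1ᵍ ≡ z *ᵍ q
unit-inverse (inj₁ e) z≢0 = ⊥-elim (z≢0 e)
unit-inverse (inj₂ (inj₁ refl)) _ = 1ᵍ , refl
unit-inverse (inj₂ (inj₂ (inj₁ refl))) _ = -ᵍ 1ᵍ , refl
unit-inverse (inj₂ (inj₂ (inj₂ (inj₁ refl)))) _ = -ᵍ iᵍ , refl
unit-inverse (inj₂ (inj₂ (inj₂ (inj₂ refl)))) _ = iᵍ , refl

square≤1 : ∀ {a} → a * a ≤ᶻ + 1 → a ≡ + 0 ⊎ a ≡ + 1 ⊎ a ≡ -[1+ 0 ]
square≤1 {a} h = sup-1 (go h) (go (lin 0 h (solve (a ∷ []))))
  where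
  go : ∀ {a} → a * a ≤ᶻ + 1 → a ≤ᶻ + 1
  go {a} h = by-cases (dichotomy a (+ 1))
    (λ a≤1 → a≤1)
    (λ 2≤a → absurd 2 (h ⊕ *-mono {a} (lin 2 2≤a (solve (a ∷ []))) 2≤a ⊕ 2≤a ⊕ 2≤a)
      (solve (a ∷ [])))

0≤square : ∀ a → + 0 ≤ᶻ a * a
0≤square (+ 0) = +≤+ ℕ.z≤n
0≤square +[1+ n ] = +≤+ ℕ.z≤n
0≤square -[1+ n ] = +≤+ ℕ.z≤n

norm≤1⇒A₀ : ∀ {a b} → a * a + b * b ≤ᶻ + 1 → A 0 ⟪ a , b ⟫
norm≤1⇒A₀ {a} {b} h =
  go (square≤1 (a * a ≤ᶻ + 1 ∋ lin 0 (h ⊕ 0≤square b) (solve (a ∷ b ∷ []))))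
    (square≤1 (b * b ≤ᶻ + 1 ∋ lin 0 (h ⊕ 0≤square a) (solve (b ∷ a ∷ [])))) h
  where
  go : ∀ {a b} → a ≡ + 0 ⊎ a ≡ + 1 ⊎ a ≡ -[1+ 0 ] → b ≡ + 0 ⊎ b ≡ + 1 ⊎ b ≡ -[1+ 0 ] →
    a * a + b * b ≤ᶻ + 1 → A 0 ⟪ a , b ⟫
  go (inj₁ refl) (inj₁ refl) _ = inj₁ refl
  go (inj₁ refl) (inj₂ (inj₁ refl)) _ = inj₂ (inj₂ (inj₂ (inj₁ refl)))
  go (inj₁ refl) (inj₂ (inj₂ refl)) _ = inj₂ (inj₂ (inj₂ (inj₂ refl)))
  go (inj₂ (inj₁ refl)) (inj₁ refl) _ = inj₂ (inj₁ refl)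
  go (inj₂ (inj₂ refl)) (inj₁ refl) _ = inj₂ (inj₂ (inj₁ refl))
  go (inj₂ (inj₁ refl)) (inj₂ (inj₁ refl)) (+≤+ (ℕ.s≤s ()))
  go (inj₂ (inj₁ refl)) (inj₂ (inj₂ refl)) (+≤+ (ℕ.s≤s ()))
  go (inj₂ (inj₂ refl)) (inj₂ (inj₁ refl)) (+≤+ (ℕ.s≤s ()))
  go (inj₂ (inj₂ refl)) (inj₂ (inj₂ refl)) (+≤+ (ℕ.s≤s ()))

-- Norms multiply: those of z and q have product 1 and the second is at least 1, so z has norm at
-- most 1.
divides-1⇒A₀ : ∀ {z q} → 1ᵍ ≡ z *ᵍ q → A 0 z
divides-1⇒A₀ {⟪ a , b ⟫} {⟪ c , d ⟫} e =
  norm≤1⇒A₀ (a * a + b * b ≤ᶻ + 1 ∋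
    lin 0 (*-mono {a * a + b * b} (0≤square a ⊕ 0≤square b) (norm-positive q≢0)
    ⊕ ℤ.≤-reflexive product) (solve (a ∷ b ∷ c ∷ d ∷ [])))
  where
  q≢0 : ⟪ c , d ⟫ ≢ 0ᵍ
  q≢0 refl = case trans (cong re e) (zero-product a b) of λ ()
    where
    zero-product : ∀ a b → a * + 0 - b * + 0 ≡ + 0
    zero-product a b = solve (a ∷ b ∷ [])
  product : (a * a + b * b) * (c * c + d * d) ≡ + 1
  product = trans (solve-product a b c d)
    (sym (cong₂ (λ x y → x * x + y * y) (cong re e) (cong im e)))
    where
    solve-product : ∀ a b c d → (a * a + b * b) * (c * c + d * d) ≡
      (a * c - b * d) * (a * c - b * d) + (a * d + b * c) * (a * d + b * c)
    solve-product a b c d = solve (a ∷ b ∷ c ∷ d ∷ [])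

-- Elements within the bounds but outside `T n`.

W-gap⁺ : ∀ n → W n + + 1 ≤ᶻ W (suc n) × W (suc n) + + 1 ≤ᶻ + 2 * W n
W-gap⁺ n = proj₁ (W-gap n) , go {W n} {W (suc n)} (proj₂ (W-gap n))
  where
  go : ∀ {a b} → b + + 2 ≤ᶻ + 2 * a → b + + 1 ≤ᶻ + 2 * a
  go {a} {b} h = (b + + 1 ≤ᶻ + 2 * a ∋ lin 1 h (solve (a ∷ b ∷ [])))

Sup-0 : ∀ {z} → Sup (+ 0) z → z ≡ 0ᵍ
Sup-0 {⟪ a , b ⟫} (sup p q r s) = cong₂ _+_i
  (ℤ.≤-antisym p (+ 0 ≤ᶻ a ∋ lin 0 q (solve (a ∷ []))))
  (ℤ.≤-antisym r (+ 0 ≤ᶻ b ∋ lin 0 s (solve (b ∷ []))))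

-- Induction by division by 1 + i. An odd z outside `T n` attains w n - 1 or w (n + 1) - 1. If z =
-- (1 + i)y has level n + 1, then y inherits the bounds at level n, since 2M(y) ≤ 2 w n - 1 gives
-- M(y) ≤ w n - 1; the two boundary alternatives change places.
T-or-Boundary : ∀ n z → Sup (W n - + 1) z → Sup (W (suc n) - + 1) (τ z) →
  T n z ⊎ Boundary (W n) (W (suc n)) z ⊎ Boundary (W (suc n)) (+ 2 * W n) (τ z)
T-or-Boundary n z s t = go (parity z)
  where
  odd : Odd z → Sup (W n - + 2) z ⊎ Exceeds (W n - + 2) z →
    Sup (W (suc n) - + 2) (τ z) ⊎ Exceeds (W (suc n) - + 2) (τ z) →
    T n z ⊎ Boundary (W n) (W (suc n)) z ⊎ Boundary (W (suc n)) (+ 2 * W n) (τ z)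
  odd o (inj₁ p) (inj₁ q) = inj₁ (T-odd (proj₂ (W-even n)) o p q)
  odd _ (inj₂ e) _ = inj₂ (inj₁ (at-edge (proj₁ (W-gap⁺ n)) (proj₂ (W-gap⁺ n)) s e))
  odd _ (inj₁ _) (inj₂ e) = inj₂ (inj₂ (at-edge (proj₂ (W-gap⁺ n))
    (subst (λ v → v + + 1 ≤ᶻ + 2 * W (suc n)) (W-step n) (proj₂ (W-gap⁺ (suc n)))) t e))

  even : ∀ n y → Sup (W n - + 1) (τ y) → Sup (W (suc n) - + 1) (τ (τ y)) →
    T n (τ y) ⊎ Boundary (W n) (W (suc n)) (τ y) ⊎ Boundary (W (suc n)) (+ 2 * W n) (τ (τ y))
  even 0 y _ t = first (Sup? (+ 0) y)
    where
    first : Sup (+ 0) y ⊎ Exceeds (+ 0) y →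
      T 0 (τ y) ⊎ Boundary (W 0) (W 1) (τ y) ⊎ Boundary (W 1) (+ 2 * W 0) (τ (τ y))
    first (inj₁ p) with refl ← Sup-0 p = inj₁ zeroᵀ
    -- Here M(y) = 1, an edge for the values 2 and 3, which continue `w` one step backwards: doubled
    -- they become w 1 and 2 w 0.
    first (inj₂ e) = inj₂ (inj₂ (subst (λ v → Boundary v (+ 2 * W 0) (τ (τ y))) (sym W₁)
      (subst (λ v → Boundary (+ 4) (+ 2 * v) (τ (τ y))) (sym W₀)
        (Boundary-ττ (at-edge {+ 2} {+ 3} ℤ.≤-refl ℤ.≤-refl
          (Sup-ττ⁻¹ (subst (λ v → Sup (v - + 1) (τ (τ y))) W₁ t)) e)))))
  even (suc n) y s t = lift (T-or-Boundary n y
      (Sup-ττ⁻¹ (Sup-mono (double (W-step n)) t)) s)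
    where
    double : ∀ {a b} → b ≡ + 2 * a → b - + 1 ≤ᶻ + 2 * (a - + 1) + + 1
    double {a} refl = lin 0 (ℤ.≤-refl {a}) (solve (a ∷ []))
    lift : T n y ⊎ Boundary (W n) (W (suc n)) y ⊎ Boundary (W (suc n)) (+ 2 * W n) (τ y) →
      T (suc n) (τ y) ⊎ Boundary (W (suc n)) (W (2 ℕ.+ n)) (τ y)
        ⊎ Boundary (W (2 ℕ.+ n)) (+ 2 * W (suc n)) (τ (τ y))
    lift (inj₁ p) = inj₁ (evenᵀ p)
    lift (inj₂ (inj₁ b)) = inj₂ (inj₂
      (subst (λ v → Boundary v (+ 2 * W (suc n)) (τ (τ y))) (sym (W-step n)) (Boundary-ττ b)))
    lift (inj₂ (inj₂ b)) = inj₂ (inj₁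
      (subst (λ v → Boundary (W (suc n)) v (τ y)) (sym (W-step n)) b))

  go : Odd z ⊎ Even z →
    T n z ⊎ Boundary (W n) (W (suc n)) z ⊎ Boundary (W (suc n)) (+ 2 * W n) (τ z)
  go (inj₁ o) = odd o (Sup? _ z) (Sup? _ (τ z))
  go (inj₂ (y , refl)) = even n y s t

-- Coverings of residue classes.

-- Every representative of the class of (1 + i)y modulo (1 + i)γ is divisible by 1 + i, so the
-- covering descends to γ.
τ-cover : ∀ {M : ℤ[i] → Set} {γ} → M ↠mod τ γ → ∀ y → ∃[ m ] M (τ m) × γ ∣ᵍ (y -ᵍ m)
τ-cover {M} {γ} cover y = let (m , m∈ , q , e) = cover (τ y) in go m m∈ q e (parity m)
  where
  go : ∀ m → M m → ∀ q → τ y -ᵍ m ≡ τ γ *ᵍ q → Odd m ⊎ Even m → ∃[ m ] M (τ m) × γ ∣ᵍ (y -ᵍ m)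
  go m m∈ q e (inj₂ (m′ , refl)) =
    m′ , m∈ , q , τ-injective (trans (τ--ᵍ y m′) (trans e (sym (τ-*ᵍ γ q))))
  go m m∈ q e (inj₁ o) = ⊥-elim (τ-not-Odd {y -ᵍ (γ *ᵍ q)} (subst Odd m≡ o))
    where
    solve-for : ∀ x m c → x -ᵍ m ≡ c → m ≡ x -ᵍ c
    solve-for ⟪ a , b ⟫ ⟪ c , d ⟫ _ refl = cong₂ _+_i
      (c ≡ a - (a - c) ∋ solve (c ∷ a ∷ []))
      (d ≡ b - (b - d) ∋ solve (d ∷ b ∷ []))
    m≡ : m ≡ τ (y -ᵍ (γ *ᵍ q))
    m≡ = trans (solve-for (τ y) m (τ γ *ᵍ q) e)
      (trans (cong (λ v → τ y -ᵍ v) (sym (τ-*ᵍ γ q))) (sym (τ--ᵍ y (γ *ᵍ q))))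

covered⇒T : ∀ n β → T n ↠mod β → T (suc n) β
covered⇒T n β cover = go (parity β)
  where
  even : ∀ n γ → T n ↠mod τ γ → T n γ
  -- The only even element of `T 0` is 0, so γ has to divide 1.
  even 0 γ cover = let (m , m∈ , q , e) = τ-cover {T 0} {γ} cover 1ᵍ in
    A₀⇒T₀ (divides-1⇒A₀ {γ} {q} (trans (cong (λ v → 1ᵍ -ᵍ v) (sym (T₀-τ {m} m∈))) e))
  even (suc n) γ cover = covered⇒T n γ λ y →
    let (m , m∈ , d) = τ-cover {T (suc n)} {γ} cover y in m , T-τ⁻¹ {n} {m} m∈ , d
  go : Odd β ⊎ Even β → T (suc n) β
  go (inj₁ o) = oddᵀ o (subst (λ v → Octagon (W (suc n)) v β) (sym (W-step n))
    (Octagon-if-covered T⇒Octagon β o cover))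
  go (inj₂ (γ , refl)) = evenᵀ (even n γ cover)

-- Modulo 2 the sum of the coordinates is multiplicative, so βu is odd while (1 + i)y is even.
Odd-shifted : ∀ {β u} y → Odd β → Odd u → Odd (τ y -ᵍ (β *ᵍ u))
Odd-shifted {⟪ a , b ⟫} {⟪ c , d ⟫} ⟪ x , y ⟫ (k , a+b≡) (l , c+d≡) =
  x - k - l - + 2 * k * l - + 1 + b * d ,
  trans (x - y - (a * c - b * d) + (x + y - (a * d + b * c))
    ≡ + 2 * x - (a + b) * (c + d) + + 2 * (b * d) ∋ solve (x ∷ y ∷ a ∷ c ∷ b ∷ d ∷ []))
      (trans (cong₂ (λ s t → + 2 * x - s * t + + 2 * (b * d)) a+b≡ c+d≡)
        (+ 2 * x - (+ 2 * k + + 1) * (+ 2 * l + + 1) + + 2 * (b * d)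
          ≡ + 2 * (x - k - l - + 2 * k * l - + 1 + b * d) + + 1 ∋ solve (x ∷ k ∷ l ∷ b ∷ d ∷ [])))

∣-shift : ∀ {β x m} u → β ∣ᵍ (x -ᵍ m) → β ∣ᵍ (x -ᵍ (m -ᵍ (β *ᵍ u)))
∣-shift {⟪ a , b ⟫} {⟪ p , q ⟫} {⟪ m , n ⟫} ⟪ c , d ⟫ (⟪ k , l ⟫ , e) = ⟪ k + c , l + d ⟫ ,
  cong₂ _+_i
    (lin≡ (cong re e) (p - (m - (a * c - b * d)) - (a * (k + c) - b * (l + d))
      ≡ p - m - (a * k - b * l) ∋ solve (p ∷ m ∷ a ∷ c ∷ b ∷ d ∷ k ∷ l ∷ [])))
    (lin≡ (cong im e) (q - (n - (a * d + b * c)) - (a * (l + d) + b * (k + c))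
      ≡ q - n - (a * l + b * k) ∋ solve (q ∷ n ∷ a ∷ d ∷ b ∷ c ∷ l ∷ k ∷ [])))

τ-∣ : ∀ {γ x m} → γ ∣ᵍ (x -ᵍ m) → τ γ ∣ᵍ (τ x -ᵍ τ m)
τ-∣ {γ} {x} {m} (q , e) = q , trans (sym (τ--ᵍ x m)) (trans (cong τ e) (τ-*ᵍ γ q))

T⇒covered : ∀ n β → β ≢ 0ᵍ → T (suc n) β → T n ↠mod β
T⇒covered n _ β≢0 zeroᵀ = ⊥-elim (β≢0 refl)
T⇒covered n β β≢0 (oddᵀ β-odd oct) x =
  let (m , d , s , t) = small-remainder β x β≢0 oct′ in go m d s t (parity m)
  where
  oct′ : Octagon (W (suc n)) (+ 2 * W n) β
  oct′ = subst (λ v → Octagon (W (suc n)) v β) (W-step n) oct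
  Goal : Set
  Goal = ∃[ m ] T n m × β ∣ᵍ (x -ᵍ m)
  W-weaken : ∀ a → a - + 2 ≤ᶻ a - + 1
  W-weaken a = lin 1 (ℤ.≤-refl {a}) (solve (a ∷ []))
  shifted : ∀ y → β ∣ᵍ (x -ᵍ τ y) → Shiftable (W n) (W (suc n) - + 2) β (τ y) → Goal
  shifted y d (u , o , s , t) = τ y -ᵍ (β *ᵍ u) ,
    T-odd (proj₂ (W-even n)) (Odd-shifted {β} {u} y β-odd o) s t , ∣-shift {β} {x} {τ y} u d
  go : ∀ m → β ∣ᵍ (x -ᵍ m) → Sup (W n - + 2) m → Sup (W (suc n) - + 2) (τ m) → Odd m ⊎ Even m → Goal
  go m d s t (inj₁ o) = m , T-odd (proj₂ (W-even n)) o s t , d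
  go _ d s t (inj₂ (y , refl)) = by-cases
    (T-or-Boundary n (τ y) (Sup-mono (W-weaken (W n)) s) (Sup-mono (W-weaken (W (suc n))) t))
    (λ p → τ y , p , d)
    (λ b → shifted y d (Boundary-shiftable b oct′ s t))
T⇒covered n _ β≢0 (evenᵀ {y = γ} t) x = go (parity x)
  where
  γ≢0 : γ ≢ 0ᵍ
  γ≢0 refl = β≢0 refl
  oct : Octagon (W (suc n)) (+ 2 * W n) (τ γ)
  oct = subst (λ v → Octagon (W (suc n)) v (τ γ)) (W-step n) (T⇒Octagon (evenᵀ t))
  even : ∀ n → T n γ → ∀ y → ∃[ m ] T n m × τ γ ∣ᵍ (τ y -ᵍ m)
  -- γ is a unit, so (1 + i)γ divides every even element and 0 represents the class.
  even 0 t y = let (q , e) = unit-inverse (T₀⇒A₀ t) γ≢0 in 0ᵍ , zeroᵀ , q *ᵍ y , multiple γ q y e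
    where
    multiple : ∀ γ q y → 1ᵍ ≡ γ *ᵍ q → τ y -ᵍ 0ᵍ ≡ τ γ *ᵍ (q *ᵍ y)
    multiple γ q y e = trans (identity y) (trans (cong (λ v → τ v *ᵍ y) e) (assoc γ q y))
      where
      identity : ∀ y → τ y -ᵍ 0ᵍ ≡ τ 1ᵍ *ᵍ y
      identity ⟪ a , b ⟫ = cong₂ _+_i
        (a - b - + 0 ≡ (+ 1 - + 0) * a - (+ 1 + + 0) * b ∋ solve (a ∷ b ∷ []))
        (a + b - + 0 ≡ (+ 1 - + 0) * b + (+ 1 + + 0) * a ∋ solve (a ∷ b ∷ []))
      assoc : ∀ x y z → τ (x *ᵍ y) *ᵍ z ≡ τ x *ᵍ (y *ᵍ z)
      assoc ⟪ a , b ⟫ ⟪ c , d ⟫ ⟪ p , q ⟫ = cong₂ _+_i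
        ((a * c - b * d - (a * d + b * c)) * p - (a * c - b * d + (a * d + b * c)) * q
          ≡ (a - b) * (c * p - d * q) - (a + b) * (c * q + d * p) ∋ solve
            (a ∷ c ∷ b ∷ d ∷ p ∷ q ∷ []))
        ((a * c - b * d - (a * d + b * c)) * q + (a * c - b * d + (a * d + b * c)) * p
          ≡ (a - b) * (c * q + d * p) + (a + b) * (c * p - d * q) ∋ solve
            (a ∷ c ∷ b ∷ d ∷ q ∷ p ∷ []))
  even (suc n) t y = let (m , m∈ , d) = T⇒covered n γ γ≢0 t y in τ m , evenᵀ m∈ , τ-∣ {γ} {y} {m} d
  go : Odd x ⊎ Even x → ∃[ m ] T n m × τ γ ∣ᵍ (x -ᵍ m)
  go (inj₂ (y , refl)) = even n t y
  -- An odd class modulo an even element has only odd representatives, for which the rounding bounds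
  -- suffice.
  go (inj₁ o) = let (m , d , s , t) = small-remainder (τ γ) x β≢0 oct in
    m , T-odd (proj₂ (W-even n)) (Odd-remainder m d) s t , d
    where
    Odd-remainder : ∀ m → τ γ ∣ᵍ (x -ᵍ m) → Odd m
    Odd-remainder m (q , e) = by-cases (parity m) (λ o′ → o′) λ { (y , refl) →
      ⊥-elim (τ-not-Odd { -ᵍ ((-ᵍ y) -ᵍ (γ *ᵍ q))}
        (subst Odd (x≡ y q (trans e (sym (τ-*ᵍ γ q)))) o)) }
      where
      x≡ : ∀ y q → x -ᵍ τ y ≡ τ (γ *ᵍ q) → x ≡ τ (-ᵍ ((-ᵍ y) -ᵍ (γ *ᵍ q)))
      x≡ y q e = rearrange x y (γ *ᵍ q) e
        where
        rearrange : ∀ x y z → x -ᵍ τ y ≡ τ z → x ≡ τ (-ᵍ ((-ᵍ y) -ᵍ z))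
        rearrange ⟪ a , b ⟫ ⟪ c , d ⟫ ⟪ p , q ⟫ e =
          cong₂ _+_i
            (lin≡ (cong re e) (a - (- (- c - p) - - (- d - q)) ≡ a - (c - d) - (p - q) ∋
              solve (a ∷ c ∷ p ∷ d ∷ q ∷ [])))
            (lin≡ (cong im e) (b - (- (- c - p) + - (- d - q)) ≡ b - (c + d) - (p + q) ∋
              solve (b ∷ c ∷ p ∷ d ∷ q ∷ [])))

-- Identification of the Motzkin sets.

0ᵍ? : ∀ z → z ≡ 0ᵍ ⊎ z ≢ 0ᵍ
0ᵍ? ⟪ a , b ⟫ with a ℤ.≟ + 0 | b ℤ.≟ + 0
... | yes refl | yes refl = inj₁ refl
... | no a≢0   | _        = inj₂ λ e → a≢0 (cong re e)
... | yes _    | no b≢0   = inj₂ λ e → b≢0 (cong im e)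

A⇒T : ∀ n {z} → A n z → T n z
T⇒A : ∀ n {z} → T n z → A n z
A⇒T 0 a = A₀⇒T₀ a
A⇒T (suc n) (inj₁ a) = T-mono (A⇒T n a)
A⇒T (suc n) {z} (inj₂ cover) = covered⇒T n z λ x →
  let (m , m∈ , d) = cover x in m , A⇒T n m∈ , d
T⇒A 0 t = T₀⇒A₀ t
T⇒A (suc n) {z} t = by-cases (0ᵍ? z)
  (λ { refl → inj₁ (T⇒A n zeroᵀ) })
  (λ z≢0 → inj₂ λ x → let (m , m∈ , d) = T⇒covered n z z≢0 t x in m , T⇒A n m∈ , d)

-- Exact powers of 2.

pow₂ : ℕ → ℤ
pow₂ j = + (2 ℕ.^ j)

pow₂-suc : ∀ j → pow₂ (suc j) ≡ + 2 * pow₂ j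
pow₂-suc j = ℤ.pos-* 2 (2 ℕ.^ j)

1≤pow₂ : ∀ j → + 1 ≤ᶻ pow₂ j
1≤pow₂ j = +≤+ (ℕ.m^n>0 2 j)

twice-injective : ∀ {y z} → twice y ≡ twice z → y ≡ z
twice-injective e = cong₂ _+_i (2*-injective (cong re e)) (2*-injective (cong im e))

ι-*ᵍ : ∀ p z → ι p *ᵍ z ≡ ⟪ p * re z , p * im z ⟫
ι-*ᵍ p ⟪ a , b ⟫ = cong₂ _+_i
  (p * a - + 0 * b ≡ p * a ∋ solve (p ∷ a ∷ b ∷ []))
  (p * b + + 0 * a ≡ p * b ∋ solve (p ∷ b ∷ a ∷ []))

ι-suc : ∀ j z → ι (pow₂ (suc j)) *ᵍ z ≡ twice (ι (pow₂ j) *ᵍ z)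
ι-suc j z = go {pow₂ j} (pow₂-suc j) z
  where
  go : ∀ {p q} → q ≡ + 2 * p → ∀ z → ι q *ᵍ z ≡ twice (ι p *ᵍ z)
  go {p} refl ⟪ a , b ⟫ = cong₂ _+_i
    (+ 2 * p * a - + 0 * b ≡ + 2 * (p * a - + 0 * b) ∋ solve (p ∷ a ∷ b ∷ []))
    (+ 2 * p * b + + 0 * a ≡ + 2 * (p * b + + 0 * a) ∋ solve (p ∷ b ∷ a ∷ []))

twice-∥ : ∀ {j y} → y ∥2^ j → twice y ∥2^ suc j
twice-∥ {j} {y} ((q , e) , ¬d) = (q , trans (cong twice e) (sym (ι-suc j q))) ,
  λ (q , e) → ¬d (q , twice-injective {y} {ι (pow₂ (suc j)) *ᵍ q} (trans e (ι-suc (suc j) q)))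

∥-suc⁻¹ : ∀ {j z} → z ∥2^ suc j → ∃[ y ] z ≡ twice y × y ∥2^ j
∥-suc⁻¹ {j} ((q , refl) , ¬d) = ι (pow₂ j) *ᵍ q , ι-suc j q , (q , refl) ,
  λ (r , e) → ¬d (r , trans (ι-suc j q) (trans (cong twice e) (sym (ι-suc (suc j) r))))

ι1-*ᵍ : ∀ z → ι (+ 1) *ᵍ z ≡ z
ι1-*ᵍ ⟪ a , b ⟫ = cong₂ _+_i
  (+ 1 * a - + 0 * b ≡ a ∋ solve (a ∷ b ∷ [])) (+ 1 * b + + 0 * a ≡ b ∋ solve (a ∷ b ∷ []))

ι2-*ᵍ : ∀ z → ι (+ 2) *ᵍ z ≡ twice z
ι2-*ᵍ ⟪ a , b ⟫ = cong₂ _+_i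
  (+ 2 * a - + 0 * b ≡ + 2 * a ∋ solve (a ∷ b ∷ []))
  (+ 2 * b + + 0 * a ≡ + 2 * b ∋ solve (a ∷ b ∷ []))

¬twice⇒∥ : ∀ {z} → ¬ (∃[ y ] z ≡ twice y) → z ∥2^ 0
¬twice⇒∥ {z} ¬d = (z , sym (ι1-*ᵍ z)) , λ (q , e) → ¬d (q , trans e (ι2-*ᵍ q))

∥⇒¬twice : ∀ {z} → z ∥2^ 0 → ∀ y → z ≢ twice y
∥⇒¬twice (_ , ¬d) y e = ¬d (y , trans e (sym (ι2-*ᵍ y)))

twice? : ∀ z → (∃[ y ] z ≡ twice y) ⊎ ¬ (∃[ y ] z ≡ twice y)
twice? ⟪ a , b ⟫ = go (parityᶻ a) (parityᶻ b)
  where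
  go : (∃[ c ] a ≡ + 2 * c + + 1) ⊎ (∃[ c ] a ≡ + 2 * c) →
    (∃[ d ] b ≡ + 2 * d + + 1) ⊎ (∃[ d ] b ≡ + 2 * d) →
    (∃[ y ] ⟪ a , b ⟫ ≡ twice y) ⊎ ¬ (∃[ y ] ⟪ a , b ⟫ ≡ twice y)
  go (inj₂ (c , e)) (inj₂ (d , e′)) = inj₁ (⟪ c , d ⟫ , cong₂ _+_i e e′)
  go (inj₁ (c , e)) _ = inj₂ λ (y , e′) → odd≢even {c} {re y} (trans (sym e) (cong re e′))
  go (inj₂ _) (inj₁ (d , e)) = inj₂ λ (y , e′) → odd≢even {d} {im y} (trans (sym e) (cong im e′))

∥⇒≢0 : ∀ {j z} → z ∥2^ j → z ≢ 0ᵍ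
∥⇒≢0 {j} (_ , ¬d) refl = ¬d (0ᵍ , sym (trans (ι-*ᵍ (pow₂ (suc j)) 0ᵍ) (cong₂ _+_i
  (ℤ.*-zeroʳ (pow₂ (suc j)))
  (ℤ.*-zeroʳ (pow₂ (suc j))))))

-- (1 + i)^2 = 2i, so the factor 2 is -i times (1 + i)^2, and -i is three rotations.
twice-ττ : ∀ z → twice z ≡ τ (τ (rot (rot (rot z))))
twice-ττ ⟪ a , b ⟫ = cong₂ _+_i
  (+ 2 * a ≡ - (- b) - - a - (- (- b) + - a) ∋ solve (a ∷ b ∷ []))
  (+ 2 * b ≡ - (- b) - - a + (- (- b) + - a) ∋ solve (b ∷ a ∷ []))

ττ-not-∥ : ∀ {y} → ¬ (τ (τ y) ∥2^ 0)
ττ-not-∥ {y} d = ∥⇒¬twice d (rot y) (trans (ττ y) (rot-twice y))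

T-rot⁻³ : ∀ {n z} → T n (rot (rot (rot z))) → T n z
T-rot⁻³ {n} {z} t = subst (T n) (rot⁴ z) (T-rot t)
  where
  rot⁴ : ∀ z → rot (rot (rot (rot z))) ≡ z
  rot⁴ ⟪ a , b ⟫ = cong₂ _+_i (ℤ.neg-involutive a) (ℤ.neg-involutive b)

T-twice⁻¹ : ∀ {n z} → T (2 ℕ.+ n) (twice z) → T n z
T-twice⁻¹ {z = z} t = T-rot⁻³ {z = z} (T-τ⁻¹ {y = y} (T-τ⁻¹ {y = τ y} (subst (T _) (twice-ττ z) t)))
  where
  y = rot (rot (rot z))

T-twice : ∀ {n z} → T n z → T (2 ℕ.+ n) (twice z)
T-twice {z = z} t = subst (T _) (sym (twice-ττ z)) (evenᵀ (evenᵀ (T-rot (T-rot (T-rot t)))))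

rot³≡0 : ∀ {z} → rot (rot (rot z)) ≡ 0ᵍ → z ≡ 0ᵍ
rot³≡0 {⟪ a , b ⟫} e = cong₂ _+_i
  (lin≡ (sym (cong im e)) (a - + 0 ≡ + 0 - - a ∋ solve (a ∷ [])))
  (lin≡ (cong re e) (b - + 0 ≡ - (- b) - + 0 ∋ solve (b ∷ [])))

T₁-twice : ∀ {z} → T 1 (twice z) → z ≡ 0ᵍ
T₁-twice {z} t = rot³≡0 {z} (T₀-τ {rot (rot (rot z))}
  (T-τ⁻¹ {0} {τ (rot (rot (rot z)))} (subst (T 1) (twice-ττ z) t)))

T₀-twice : ∀ {z} → T 0 (twice z) → z ≡ 0ᵍ
T₀-twice {z} t = T₁-twice {z} (T-mono t)

-- Halving lowers the level by 2, and `T 0` and `T 1` contain no nonzero multiple of 2, so halving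
-- comes to an end.
exponent : ∀ n {z} → T n z → z ≢ 0ᵍ → ∃[ j ] z ∥2^ j
exponent n {z} t z≢0 = by-cases (twice? z) (λ (y , e) → double n y e t) (λ ¬d → 0 , ¬twice⇒∥ ¬d)
  where
  double : ∀ n y → z ≡ twice y → T n z → ∃[ j ] z ∥2^ j
  double 0 y refl t = ⊥-elim (z≢0 (cong twice (T₀-twice {y} t)))
  double 1 y refl t = ⊥-elim (z≢0 (cong twice (T₁-twice {y} t)))
  double (suc (suc n)) y refl t =
    let (j , d) = exponent n (T-twice⁻¹ {n} {y} t)
          (λ e → z≢0 (cong twice e)) in suc j , twice-∥ {j} {y} d

-- Explicit bounds for `T n`.

-- The bounds of the theorem for exponent j; j = 0 gives the octagon of level n.
record Level (n j : ℕ) (z : ℤ[i]) : Set where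
  constructor level
  field
    max≤ : Sup (W n - + 2 * pow₂ j) z
    sum≤ : Sup (W (suc n) - + 3 * pow₂ j) (τ z)

τ-twice : ∀ z → τ (twice z) ≡ twice (τ z)
τ-twice ⟪ a , b ⟫ = cong₂ _+_i
  (+ 2 * a - + 2 * b ≡ + 2 * (a - b) ∋ solve (a ∷ b ∷ []))
  (+ 2 * a + + 2 * b ≡ + 2 * (a + b) ∋ solve (a ∷ b ∷ []))

Level-twice : ∀ {n j z} → Level n j z → Level (2 ℕ.+ n) (suc j) (twice z)
Level-twice {n} {j} {z} (level s t) = level
  (subst (λ v → Sup v (twice z)) (e (W n) (pow₂ j) (W-step n) (pow₂-suc j)) (Sup-twice {z = z} s))
  (subst (Sup _) (sym (τ-twice z))
    (subst (λ v → Sup v (twice (τ z))) (e′ (W (suc n)) (pow₂ j) (W-step (suc n)) (pow₂-suc j))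
      (Sup-twice {z = τ z} t)))
  where
  e : ∀ a p {b q} → b ≡ + 2 * a → q ≡ + 2 * p → + 2 * (a - + 2 * p) ≡ b - + 2 * q
  e a p refl refl = solve (a ∷ p ∷ [])
  e′ : ∀ a p {b q} → b ≡ + 2 * a → q ≡ + 2 * p → + 2 * (a - + 3 * p) ≡ b - + 3 * q
  e′ a p refl refl = solve (a ∷ p ∷ [])

Level-twice⁻¹ : ∀ {n j z} → Level (2 ℕ.+ n) (suc j) (twice z) → Level n j z
Level-twice⁻¹ {n} {j} {z} (level s t) = level
  (Sup-twice⁻¹ {z = z} (Sup-mono (e (W n) (pow₂ j) (W-step n) (pow₂-suc j)) s))
  (Sup-twice⁻¹ {z = τ z} (Sup-mono (e′ (W (suc n)) (pow₂ j) (W-step (suc n)) (pow₂-suc j))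
    (subst (Sup _) (τ-twice z) t)))
  where
  e : ∀ a p {b q} → b ≡ + 2 * a → q ≡ + 2 * p → b - + 2 * q ≤ᶻ + 2 * (a - + 2 * p) + + 1
  e a p refl refl = lin 1 (ℤ.≤-refl {a}) (solve (a ∷ p ∷ []))
  e′ : ∀ a p {b q} → b ≡ + 2 * a → q ≡ + 2 * p → b - + 3 * q ≤ᶻ + 2 * (a - + 3 * p) + + 1
  e′ a p refl refl = lin 1 (ℤ.≤-refl {a}) (solve (a ∷ p ∷ []))

Sup-negative : ∀ {K z} {A : Set} → K + + 1 ≤ᶻ + 0 → Sup K z → A
Sup-negative {K} {⟪ a , b ⟫} h (sup p q _ _) = absurd 1 (p ⊕ q ⊕ h ⊕ h) (solve (a ∷ K ∷ []))

-- Each of the j halvings takes 2 from n and halves both bounds, down to the octagon at j = 0.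
T⇒Level : ∀ j n {z} → z ∥2^ j → T n z → j ℕ.* 2 ≤ n × Level n j z
T⇒Level 0 n d t = ℕ.z≤n , level (Octagon.max≤ (T⇒Octagon t)) (Octagon.sum≤ (T⇒Octagon t))
T⇒Level (suc j) n {z} d t = let (y , e , d′) =
                                  ∥-suc⁻¹ {j} d in go n y (∥⇒≢0 {j} d′) d′ (subst (T n) e t) e
  where
  go : ∀ n y → y ≢ 0ᵍ → y ∥2^ j → T n (twice y) → z ≡ twice y → suc j ℕ.* 2 ≤ n × Level n (suc j) z
  go 0 y y≢0 _ t _ = ⊥-elim (y≢0 (T₀-twice {y} t))
  go 1 y y≢0 _ t _ = ⊥-elim (y≢0 (T₁-twice {y} t))
  go (suc (suc n)) y _ d t refl =
    let (l , m) = T⇒Level j n d (T-twice⁻¹ {n} {y} t) in ℕ.s≤s (ℕ.s≤s l) , Level-twice {n} {j} {y} m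

-- For j = 0 an even z of level n + 1 is (1 + i)y with y odd, since 2 does not divide z. Then 2M(y)
-- ≤ 2 w n - 3 gives M(y) ≤ w n - 2, and parity sharpens the bound on L(y).
Level⇒T : ∀ j n {z} → z ∥2^ j → Level n j z → T n z
Level⇒T 0 n {z} d (level s t) = by-cases (parity z) (λ o → oddᵀ o (octagon s t))
  (λ { (y , refl) → even n y d s t })
  where
  even : ∀ n y → τ y ∥2^ 0 → Sup (W n - + 2) (τ y) → Sup (W (suc n) - + 3) (τ (τ y)) → T n (τ y)
  even 0 y d s t = subst (λ y → T 0 (τ y))
    (sym (Sup-0 (Sup-ττ⁻¹ {+ 0} {y} (subst (λ v → Sup (v - + 3) (τ (τ y))) W₁ t)))) zeroᵀ
  even (suc n) y d s t = by-cases (parity y)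
    (λ o → evenᵀ (T-odd {z = y} (proj₂ (W-even n)) o
      (Sup-ττ⁻¹ {z = y} (Sup-mono (e (W-step n)) t)) s))
    (λ { (x , refl) → ⊥-elim (ττ-not-∥ {x} d) })
    where
    e : ∀ {a b} → b ≡ + 2 * a → b - + 3 ≤ᶻ + 2 * (a - + 2) + + 1
    e {a} refl = lin 0 (ℤ.≤-refl {a}) (solve (a ∷ []))
Level⇒T (suc j) n {z} d l = let (y , e , d′) = ∥-suc⁻¹ {j} d in
  subst (T n) (sym e) (go n y d′ (subst (Level n (suc j)) e l))
  where
  go : ∀ n y → y ∥2^ j → Level n (suc j) (twice y) → T n (twice y)
  -- Since 2^(j+1) ≥ 2, the bound on L is negative at level 0, and at level 1 the bound on M is at
  -- most 0.
  go 0 y _ (level s t) = Sup-negative {z = τ (twice y)} (e (pow₂ j) W₁ (pow₂-suc j) (1≤pow₂ j)) t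
    where
    e : ∀ p {a q} → a ≡ + 4 → q ≡ + 2 * p → + 1 ≤ᶻ p → a - + 3 * q + + 1 ≤ᶻ + 0
    e p refl refl h = lin 1 (h ⊕ h ⊕ (h ⊕ h) ⊕ (h ⊕ h)) (solve (p ∷ []))
  go 1 y _ (level s t) = subst (T 1)
    (sym (Sup-0 {twice y} (Sup-mono (e (pow₂ j) W₁ (pow₂-suc j) (1≤pow₂ j)) s))) zeroᵀ
    where
    e : ∀ p {a q} → a ≡ + 4 → q ≡ + 2 * p → + 1 ≤ᶻ p → a - + 2 * q ≤ᶻ + 0
    e p refl refl h = lin 0 (h ⊕ h ⊕ (h ⊕ h)) (solve (p ∷ []))
  go (suc (suc n)) y d l = T-twice {n} {y} (Level⇒T j n d (Level-twice⁻¹ {n} {j} {y} l))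

-- Translation to absolute values.

a≤∣a∣ : ∀ a → a ≤ᶻ + ∣ a ∣ × - a ≤ᶻ + ∣ a ∣
a≤∣a∣ (+ 0) = ℤ.≤-refl , ℤ.≤-refl
a≤∣a∣ +[1+ n ] = ℤ.≤-refl , ℤ.-≤+
a≤∣a∣ -[1+ n ] = ℤ.-≤+ , ℤ.≤-refl

∣a∣-cases : ∀ a → (Q : ℤ → Set) → Q a → Q (- a) → Q (+ ∣ a ∣)
∣a∣-cases (+ n) Q p _ = p
∣a∣-cases -[1+ n ] Q _ q = q

Bounded : (K L : ℤ) → ℤ[i] → Set
Bounded K L z = + ∣ re z ∣ ≤ᶻ K × + ∣ im z ∣ ≤ᶻ K × + (∣ re z ∣ ℕ.+ ∣ im z ∣) ≤ᶻ L

Bounded⇒Sup : ∀ {K L z} → Bounded K L z → Sup K z × Sup L (τ z)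
Bounded⇒Sup {K} {L} {⟪ a , b ⟫} (p , q , r) =
  sup (ℤ.≤-trans a≤ p) (ℤ.≤-trans -a≤ p) (ℤ.≤-trans b≤ q) (ℤ.≤-trans -b≤ q) , sums a≤ -a≤ b≤ -b≤ r
  where
  a≤ = proj₁ (a≤∣a∣ a)
  -a≤ = proj₂ (a≤∣a∣ a)
  b≤ = proj₁ (a≤∣a∣ b)
  -b≤ = proj₂ (a≤∣a∣ b)
  sums : ∀ {a b x y} → a ≤ᶻ x → - a ≤ᶻ x → b ≤ᶻ y → - b ≤ᶻ y → x + y ≤ᶻ L → Sup L (τ ⟪ a , b ⟫)
  sums {a} {b} {x} {y} p q r s h = sup
    (a - b ≤ᶻ L ∋ lin 0 (p ⊕ s ⊕ h) (solve (L ∷ a ∷ b ∷ x ∷ y ∷ [])))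
    (- (a - b) ≤ᶻ L ∋ lin 0 (q ⊕ r ⊕ h) (solve (L ∷ a ∷ b ∷ x ∷ y ∷ [])))
    (a + b ≤ᶻ L ∋ lin 0 (p ⊕ r ⊕ h) (solve (L ∷ a ∷ b ∷ x ∷ y ∷ [])))
    (- (a + b) ≤ᶻ L ∋ lin 0 (q ⊕ s ⊕ h) (solve (L ∷ a ∷ b ∷ x ∷ y ∷ [])))

Sup⇒Bounded : ∀ {K L z} → Sup K z → Sup L (τ z) → Bounded K L z
Sup⇒Bounded {K} {L} {⟪ a , b ⟫} (sup p q r s) (sup p′ q′ r′ s′) =
  ∣a∣-cases a (_≤ᶻ K) p q , ∣a∣-cases b (_≤ᶻ K) r s ,
  ∣a∣-cases a (λ x → x + + ∣ b ∣ ≤ᶻ L)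
    (∣a∣-cases b (λ y → a + y ≤ᶻ L) r′ p′)
    (∣a∣-cases b (λ y → - a + y ≤ᶻ L)
      (lin 0 q′ (L - (- a + b) ≡ L - - (a - b) + + 0 ∋ solve (L ∷ a ∷ b ∷ [])))
        (lin 0 s′ (L - (- a + - b) ≡ L - - (a + b) + + 0 ∋ solve (L ∷ a ∷ b ∷ []))))

-- The complement of `Bounded`. Taken one level down, it is the "either ... or" condition of the
-- theorem.
Exceeding : (K L : ℤ) → ℤ[i] → Set
Exceeding K L z = + (∣ re z ∣ ℕ.⊔ ∣ im z ∣) ℤ.> K ⊎ + (∣ re z ∣ ℕ.+ ∣ im z ∣) ℤ.> L

¬Bounded⇒Exceeding : ∀ {K L z} → ¬ Bounded K L z → Exceeding K L z
¬Bounded⇒Exceeding {K} {L} {z} ¬b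
  with + (∣ re z ∣ ℕ.⊔ ∣ im z ∣) ℤ.≤? K | + (∣ re z ∣ ℕ.+ ∣ im z ∣) ℤ.≤? L
... | no p  | _     = inj₁ (ℤ.≰⇒> p)
... | yes _ | no q  = inj₂ (ℤ.≰⇒> q)
... | yes p | yes q = ⊥-elim (¬b
  ( ℤ.≤-trans (+≤+ (ℕ.m≤m⊔n ∣ re z ∣ ∣ im z ∣)) p
  , ℤ.≤-trans (+≤+ (ℕ.m≤n⊔m ∣ re z ∣ ∣ im z ∣)) p , q))

Exceeding⇒¬Bounded : ∀ {K L z} → Exceeding K L z → ¬ Bounded K L z
Exceeding⇒¬Bounded {K} {z = z} (inj₁ h) (p , q , _) = ℤ.<⇒≱ h
  (by-cases (ℕ.⊔-sel ∣ re z ∣ ∣ im z ∣)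
    (λ e → subst (λ v → + v ≤ᶻ K) (sym e) p) (λ e → subst (λ v → + v ≤ᶻ K) (sym e) q))
Exceeding⇒¬Bounded (inj₂ h) (_ , _ , r) = ℤ.<⇒≱ h r

max-bound sum-bound : ℕ → ℕ → ℤ
max-bound n j = ℤ⟨ w n ⟩ - ℤ⟨ 2 ℕ.^ suc j ⟩
sum-bound n j = ℤ⟨ w (suc n) ⟩ - ℤ⟨ 3 ℕ.* 2 ℕ.^ j ⟩

max-bound≡ : ∀ n j → max-bound n j ≡ W n - + 2 * pow₂ j
max-bound≡ n j = cong₂ _-_ (sym (W≡w n)) (ℤ.pos-* 2 (2 ℕ.^ j))

sum-bound≡ : ∀ n j → sum-bound n j ≡ W (suc n) - + 3 * pow₂ j
sum-bound≡ n j = cong₂ _-_ (sym (W≡w (suc n))) (ℤ.pos-* 3 (2 ℕ.^ j))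

T⇒Bounded : ∀ {n j z} → z ∥2^ j → T n z → Bounded (max-bound n j) (sum-bound n j) z
T⇒Bounded {n} {j} {z} d t = let (_ , level s s′) = T⇒Level j n d t in Sup⇒Bounded
  (subst (λ K → Sup K z) (sym (max-bound≡ n j)) s)
  (subst (λ K → Sup K (τ z)) (sym (sum-bound≡ n j)) s′)

Bounded⇒T : ∀ {n j z} → z ∥2^ j → Bounded (max-bound n j) (sum-bound n j) z → T n z
Bounded⇒T {n} {j} {z} d b = let (s , s′) = Bounded⇒Sup b in Level⇒T j n d (level
  (subst (λ K → Sup K z) (max-bound≡ n j) s) (subst (λ K → Sup K (τ z)) (sum-bound≡ n j) s′))

-- Fibres of φ.

φ⇒T : ∀ {n z} → φ z ≡ n → T n z
φ⇒T {n} (_ , a , _) = A⇒T n a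

-- The sets `T n` increase with n, so missing one of them means missing all earlier ones.
T⇒φ : ∀ {n z} → z ≢ 0ᵍ → T (suc n) z → ¬ T n z → φ z ≡ suc n
T⇒φ {n} z≢0 t ¬t = z≢0 , T⇒A (suc n) t , λ m m<1+n a → ¬t (raise (ℕ.≤⇒≤′ (ℕ.s≤s⁻¹ m<1+n)) (A⇒T m a))
  where
  raise : ∀ {m n z} → m ℕ.≤′ n → T m z → T n z
  raise (ℕ.≤′-reflexive refl) t = t
  raise (ℕ.≤′-step h) t = T-mono (raise h t)

-- With j the exact exponent of z, membership in `T (suc n)` gives the upper bounds and absence from
-- `T n` gives the final disjunction.
φ⇒Piece : ∀ n {z} → φ z ≡ suc n → ∃[ j ] j ℕ.* 2 ≤ suc n × Piece (suc n) n j z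
φ⇒Piece n {z} f@(z≢0 , a , minimal) = let
    t = φ⇒T {suc n} f
    (j , d) = exponent (suc n) t z≢0
    (p , q , r) = T⇒Bounded {suc n} {j} d t
  in j , proj₁ (T⇒Level j (suc n) d t) , d , p , q , r ,
     ¬Bounded⇒Exceeding {z = z} λ b → minimal n (ℕ.n<1+n n) (T⇒A n (Bounded⇒T {n} {j} d b))

Piece⇒φ : ∀ {n j z} → Piece (suc n) n j z → φ z ≡ suc n
Piece⇒φ {n} {j} {z} (d , p , q , r , h) = T⇒φ (∥⇒≢0 {j} d) (Bounded⇒T {suc n} {j} d (p , q , r))
  λ t → Exceeding⇒¬Bounded {z = z} h (T⇒Bounded {n} {j} d t)

-- The largest exponent and the associates of 2^k.

j*2≤1+2k⇒j≤k : ∀ {j k} → j ℕ.* 2 ≤ suc (2 ℕ.* k) → j ≤ k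
j*2≤1+2k⇒j≤k {j} {k} h = ℕ.≮⇒≥ λ k<j → ℕ.<⇒≱ (ℕ.n<1+n (suc (2 ℕ.* k)))
  (ℕ.≤-trans (ℕ.≤-trans (ℕ.≤-reflexive (cong (2 ℕ.+_) (ℕ.*-comm 2 k))) (ℕ.*-monoˡ-≤ 2 k<j)) h)

-- The k halvings use up the whole level 2k and leave an element of `T 0`.
top-T : ∀ k {z} → z ∥2^ k → T (k ℕ.* 2) z → ∃[ u ] T 0 u × z ≡ ι (pow₂ k) *ᵍ u
top-T 0 {z} _ t = z , t , sym (ι1-*ᵍ z)
top-T (suc k) {z} d t with (y , refl , d′) ← ∥-suc⁻¹ {k} {z} d =
  let (u , t′ , e) = top-T k d′ (T-twice⁻¹ {k ℕ.* 2} {y} t) in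
  u , t′ , trans (cong twice e) (sym (ι-suc k u))

T-top : ∀ k {u} → T 0 u → T (k ℕ.* 2) (ι (pow₂ k) *ᵍ u)
T-top 0 {u} t = subst (T 0) (sym (ι1-*ᵍ u)) t
T-top (suc k) {u} t = subst (T _) (sym (ι-suc k u)) (T-twice {z = ι (pow₂ k) *ᵍ u} (T-top k t))

-- If 2^(k+1) divided 2^k u, both coordinates of u would be even, against their odd sum.
∥-top : ∀ k {u} → Odd u → (ι (pow₂ k) *ᵍ u) ∥2^ k
∥-top k {u} (c , o) = (u , refl) , λ (q , e) → odd≢even {c} {re q + im q} (trans (sym o)
  (halve q (trans (sym (ι-*ᵍ (pow₂ k) u))
    (trans e (trans (ι-suc k q) (cong twice (ι-*ᵍ (pow₂ k) q)))))))
  where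
  instance
    pow₂-nonZero : ℤ.NonZero (pow₂ k)
    pow₂-nonZero = ℤ.>-nonZero (ℤ.suc[i]≤j⇒i<j (1≤pow₂ k))
  cancel : ∀ x y → pow₂ k * x ≡ + 2 * (pow₂ k * y) → x ≡ + 2 * y
  cancel x y e = ℤ.*-cancelˡ-≡ (pow₂ k) x (+ 2 * y) (trans e (swap (pow₂ k) y))
    where
    swap : ∀ p y → + 2 * (p * y) ≡ p * (+ 2 * y)
    swap p y = solve (p ∷ y ∷ [])
  halve : ∀ q → ⟪ pow₂ k * re u , pow₂ k * im u ⟫ ≡ twice ⟪ pow₂ k * re q , pow₂ k * im q ⟫ →
    re u + im u ≡ + 2 * (re q + im q)
  halve q e = trans (cong₂ _+_ (cancel (re u) (re q) (cong re e))
    (cancel (im u) (im q) (cong im e)))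
    (sym (ℤ.*-distribˡ-+ (+ 2) (re q) (im q)))

Associate : ℕ → ℤ[i] → Set
Associate k z = (z ≡ ⟪ + (2 ℕ.^ k) , + 0 ⟫) ⊎ (z ≡ ⟪ - (+ (2 ℕ.^ k)) , + 0 ⟫)
  ⊎ (z ≡ ⟪ + 0 , + (2 ℕ.^ k) ⟫) ⊎ (z ≡ ⟪ + 0 , - (+ (2 ℕ.^ k)) ⟫)

ι-1 : ∀ p → ι p *ᵍ 1ᵍ ≡ ⟪ p , + 0 ⟫
ι-1 p = cong₂ _+_i
  (p * + 1 - + 0 * + 0 ≡ p ∋ solve (p ∷ []))
  (p * + 0 + + 0 * + 1 ≡ + 0 ∋ solve (p ∷ []))
ι--1 : ∀ p → ι p *ᵍ (-ᵍ 1ᵍ) ≡ ⟪ - p , + 0 ⟫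
ι--1 p = cong₂ _+_i
  (p * - (+ 1) - + 0 * - (+ 0) ≡ - p ∋ solve (p ∷ []))
  (p * - (+ 0) + + 0 * - (+ 1) ≡ + 0 ∋ solve (p ∷ []))
ι-i : ∀ p → ι p *ᵍ iᵍ ≡ ⟪ + 0 , p ⟫
ι-i p = cong₂ _+_i
  (p * + 0 - + 0 * + 1 ≡ + 0 ∋ solve (p ∷ []))
  (p * + 1 + + 0 * + 0 ≡ p ∋ solve (p ∷ []))
ι--i : ∀ p → ι p *ᵍ (-ᵍ iᵍ) ≡ ⟪ + 0 , - p ⟫
ι--i p = cong₂ _+_i
  (p * - (+ 0) - + 0 * - (+ 1) ≡ + 0 ∋ solve (p ∷ []))
  (p * - (+ 1) + + 0 * - (+ 0) ≡ - p ∋ solve (p ∷ []))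

multiple⇒Associate : ∀ k {u z} → A 0 u → z ≢ 0ᵍ → z ≡ ι (pow₂ k) *ᵍ u → Associate k z
multiple⇒Associate k (inj₁ refl) z≢0 e = ⊥-elim (z≢0 (trans e (ι-0 (pow₂ k))))
  where
  ι-0 : ∀ p → ι p *ᵍ 0ᵍ ≡ 0ᵍ
  ι-0 p = cong₂ _+_i
    (p * + 0 - + 0 * + 0 ≡ + 0 ∋ solve (p ∷ []))
    (p * + 0 + + 0 * + 0 ≡ + 0 ∋ solve (p ∷ []))
multiple⇒Associate k (inj₂ (inj₁ refl)) _ e = inj₁ (trans e (ι-1 (pow₂ k)))
multiple⇒Associate k (inj₂ (inj₂ (inj₁ refl))) _ e = inj₂ (inj₁ (trans e (ι--1 (pow₂ k))))
multiple⇒Associate k (inj₂ (inj₂ (inj₂ (inj₁ refl)))) _ e =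
  inj₂ (inj₂ (inj₁ (trans e (ι-i (pow₂ k)))))
multiple⇒Associate k (inj₂ (inj₂ (inj₂ (inj₂ refl)))) _ e =
  inj₂ (inj₂ (inj₂ (trans e (ι--i (pow₂ k)))))

Associate⇒multiple : ∀ k {z} → Associate k z → ∃[ u ] A 0 u × Odd u × z ≡ ι (pow₂ k) *ᵍ u
Associate⇒multiple k (inj₁ e) =
  1ᵍ , inj₂ (inj₁ refl) , (+ 0 , refl) , trans e (sym (ι-1 (pow₂ k)))
Associate⇒multiple k (inj₂ (inj₁ e)) =
  -ᵍ 1ᵍ , inj₂ (inj₂ (inj₁ refl)) , (-[1+ 0 ] , refl) , trans e (sym (ι--1 (pow₂ k)))
Associate⇒multiple k (inj₂ (inj₂ (inj₁ e))) =
  iᵍ , inj₂ (inj₂ (inj₂ (inj₁ refl))) , (+ 0 , refl) , trans e (sym (ι-i (pow₂ k)))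
Associate⇒multiple k (inj₂ (inj₂ (inj₂ e))) =
  -ᵍ iᵍ , inj₂ (inj₂ (inj₂ (inj₂ refl))) , (-[1+ 0 ] , refl) , trans e (sym (ι--i (pow₂ k)))

φ⇔OddRHS : ∀ k z → (φ z ≡ (2 ℕ.* k ℕ.+ 1)) ⇔ OddRHS k z
φ⇔OddRHS k z rewrite ℕ.+-comm (2 ℕ.* k) 1 = mk⇔
  (λ f → let (j , l , p) = φ⇒Piece (2 ℕ.* k) f in j , j*2≤1+2k⇒j≤k l , p)
  (λ (j , _ , p) → Piece⇒φ {2 ℕ.* k} {j} p)

φ⇔EvenRHS : ∀ k z → (φ z ≡ (2 ℕ.* suc k)) ⇔ EvenRHS (suc k) z
φ⇔EvenRHS k z = mk⇔ to from
  where
  -- `2 * suc k` reduces to `suc n`, so the results for `suc n` apply without transport.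
  n = 2 ℕ.* suc k ℕ.∸ 1
  last : φ z ≡ suc n → z ∥2^ suc k → Associate (suc k) z
  last f d = let (u , t , e) = top-T (suc k) d (subst (λ m → T m z) (ℕ.*-comm 2 (suc k)) (φ⇒T f)) in
    multiple⇒Associate (suc k) (T₀⇒A₀ t) (proj₁ f) e
  to : φ z ≡ suc n → EvenRHS (suc k) z
  to f = let (j , l , p) = φ⇒Piece n f in by-cases
    (ℕ.m≤n⇒m<n∨m≡n (j*2≤1+2k⇒j≤k {j} {suc k} (ℕ.m≤n⇒m≤1+n l)))
    (λ j<k → inj₂ (j , j<k , p))
    -- At the largest exponent only the four associates of the power of 2 remain.
    (λ j≡k → inj₁ (last f (subst (z ∥2^_) j≡k (proj₁ p))))
  from : EvenRHS (suc k) z → φ z ≡ suc n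
  from (inj₂ (j , _ , p)) = Piece⇒φ {n} {j} p
  from (inj₁ a) with (u , t , o , refl) ← Associate⇒multiple (suc k) a = T⇒φ
    (∥⇒≢0 {suc k} (∥-top (suc k) o))
    (subst (λ m → T m (ι (pow₂ (suc k)) *ᵍ u)) (ℕ.*-comm (suc k) 2) (T-top (suc k) (A₀⇒T₀ t)))
    -- Exponent k + 1 requires a level of at least 2(k + 1) = n + 1, which excludes `T n`.
    λ t → ℕ.<⇒≱ (ℕ.n<1+n n) (subst (_≤ n) (ℕ.*-comm (suc k) 2)
      (proj₁ (T⇒Level (suc k) n (∥-top (suc k) o) t)))

theorem1p3 : (k : ℕ) → 1 ≤ k →
    ((z : ℤ[i]) → (φ z ≡ (2 Data.Nat.* k Data.Nat.+ 1)) ⇔ OddRHS k z)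
    × ((z : ℤ[i]) → (φ z ≡ (2 Data.Nat.* k)) ⇔ EvenRHS k z)
theorem1p3 (suc k) _ = φ⇔OddRHS (suc k) , φ⇔EvenRHS k
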